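{- For each of the problems LoadCVRP, GasCVRP, and LoadGasCVRP, there is an algorithm that computes an optimal routing in $|C|^{O(|C|)}\cdot n^{O(1)}$ steps, where $C$ is the set of clients and $n=|V(G)|$ is the number of vertices of the input graph.
   Context: All graphs are finite and undirected, and $\mathbb N = \{0,1,2,\dots\}$, $\mathbb N^+=\{1,2,\dots\}$. A walk in $G$ is a sequence of vertices $(v_1,\dots,v_m)$ with consecutive vertices adjacent; vertices and edges may be repeated. It is closed if $v_1 = v_m$. The weight of a walk is $w(p)=\sum_{i=1}^{m-1} w(v_i,v_{i+1})$. Common setting: an instance contains a graph $G$ with edge weights $w\colon E(G)\to\mathbb N$, a nonempty set of depots $D\subseteq V(G)$, a set of clients $C\subseteq V(G)$, and a number of vehicles $k\in\mathbb N$. A routing is a set of $k'$ walks $R=\{p_1,\dots,p_{k'}\}$ (one walk per vehicle) together with an assignment $A\colon C\to[k']$ such that $k'\le k$, every walk starts at a vertex of $D$, every client $c\in C$ is a vertex of $p_{A(c)}$, every walk in $R$ is closed, and the additional constraints below hold. Its weight is $w(R)=\sum_{p\in R}w(p)$; a routing of minimum weight is called optimal. LoadCVRP (Load-Capacitated Vehicle Routing Problem): the instance additionally contains a load capacity $\ell\in\mathbb N$ and demands $\Lambda\colon C\to\mathbb N^+$; the additional constraint is $\sum_{c\in A^{ -1}(i)}\Lambda(c)\le\ell$ for every $i\in[k']$. GasCVRP (Gas-Capacitated Vehicle Routing Problem): the instance additionally contains a gas capacity $g\in\mathbb N$; the additional constraint is $w(p)\le g$ for every $p\in R$. LoadGasCVRP: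 the instance additionally contains $\ell$, $\Lambda$ and $g$, and both constraints are imposed. -}

module Defs where

open import Data.Bool.Base using (if_then_else_)
open import Data.Fin.Base using (Fin; zero; suc; toℕ)
open import Data.Fin.Properties using (_≟_)
open import Data.Fin.Subset using (Subset; inside; outside; _∈_; Nonempty; ∣_∣)
open import Data.List.Base as List using (List; []; _∷_; _++_; tabulate)
import Data.List.Membership.Propositional as List∈
open import Data.List.NonEmpty.Base as List⁺ using (List⁺; toList)
open import Data.List.Relation.Unary.Linked using (Linked; []; [-]; _∷_)
open import Data.Maybe.Base using (Maybe; just; maybe)
open import Data.Nat.Base using (ℕ; suc; _+_; _*_; _∸_; _^_; _≤_; _<_)
open import Data.Nat.ListAction using (sum)
open import Data.Product.Base using (Σ; Σ-syntax; ∃; ∃-syntax; _×_; _,_; proj₁; proj₂)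
open import Data.Vec.Base as Vec using (Vec; []; _∷_)
open import Relation.Binary.PropositionalEquality.Core using (_≡_)
open import Relation.Nullary.Decidable.Core using (does)
open import Relation.Nullary.Negation.Core using (¬_)

private
  variable
    a b m : ℕ

-- `weight u v ≡ just ω` : uv is an edge, of weight ω;
-- `weight u v ≡ nothing` : uv is not an edge.  Loops are not excluded.

record WeightedGraph : Set where
  field
    n          : ℕ
    weight     : Fin n → Fin n → Maybe ℕ
    undirected : ∀ u v → weight u v ≡ weight v u

  Adjacent : Fin n → Fin n → Set
  Adjacent u v = ∃[ ω ] weight u v ≡ just ω

  totalWeight : ∀ {vs} → Linked Adjacent vs → ℕ
  totalWeight []            = 0
  totalWeight [-]           = 0
  totalWeight ((ω , _) ∷ l) = ω + totalWeight l

  record Walk : Set where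
    field
      vertices : List⁺ (Fin n)
      linked   : Linked Adjacent (toList vertices)

    start end : Fin n
    start = List⁺.head vertices
    end   = List⁺.last vertices

    Visits : Fin n → Set
    Visits v = v List∈.∈ toList vertices

    walkWeight : ℕ
    walkWeight = totalWeight linked

tabulateOn : ∀ {X : Set} {n} (S : Subset n) → (∀ v → v ∈ S → X) → List X
tabulateOn []            f = []
tabulateOn (inside  ∷ S) f =
  f zero Vec.here ∷ tabulateOn S (λ v v∈S → f (suc v) (Vec.there v∈S))
tabulateOn (outside ∷ S) f =
  tabulateOn S (λ v v∈S → f (suc v) (Vec.there v∈S))

record Common : Set where
  field
    graph : WeightedGraph
  open WeightedGraph graph public
  field
    depots    : Subset n
    hasDepot  : Nonempty depots
    clients   : Subset n
    vehicles  : ℕ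

-- The walks form a family indexed by the vehicles, not a set: vehicles
-- following the same walk each contribute to the weight.

record Routing (I : Common) : Set where
  open Common I
  open Walk
  field
    k′       : ℕ
    k′≤k     : k′ ≤ vehicles
    walk     : Fin k′ → Walk
    assign   : ∀ c → c ∈ clients → Fin k′
    atDepot  : ∀ i → start (walk i) ∈ depots
    closed   : ∀ i → start (walk i) ≡ end (walk i)
    served   : ∀ c (c∈C : c ∈ clients) → Visits (walk (assign c c∈C)) c

  routingWeight : ℕ
  routingWeight = sum (tabulate (λ i → walkWeight (walk i)))

record Load (I : Common) : Set where
  open Common I
  field
    capacity : ℕ
    demand   : ∀ c → c ∈ clients → ℕ
    positive : ∀ c (c∈C : c ∈ clients) → 0 < demand c c∈C

  WithinLoad : Routing I → Set
  WithinLoad R = ∀ i →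
    sum (tabulateOn clients λ c c∈C →
           if does (assign c c∈C ≟ i) then demand c c∈C else 0)
      ≤ capacity
    where open Routing R

record Gas (I : Common) : Set where
  field
    capacity : ℕ

  WithinGas : Routing I → Set
  WithinGas R = ∀ i → walkWeight (walk i) ≤ capacity
    where open Routing R; open Common.Walk I

-- Model of computation: first-order recursive programs over lists and
-- natural numbers, with a big-step semantics that counts steps.  The language
-- is Turing-complete.  Every rule costs one step (argument lists cost nothing
-- beyond the arguments themselves), which stands for a bounded number of
-- operations of a unit-cost RAM with addition, truncated subtraction and
-- comparison, environments and lists being linked cells, shared and never
-- copied.  There is no multiplication, so the largest bit length grows by at
-- most one per step.

data Val : Set where
  num  : ℕ → Val
  nil  : Val
  cons : Val → Val → Val

-- `Exp a m` : expressions in the body of a function of a arguments, with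
-- m variables in scope.

data Exp (a : ℕ) : ℕ → Set

data Fun : ℕ → Set where
  fun : Exp a a → Fun a

data Exp a where
  var      : Fin m → Exp a m
  lit      : ℕ → Exp a m
  nil      : Exp a m
  cons     : Exp a m → Exp a m → Exp a m
  add      : Exp a m → Exp a m → Exp a m
  monus    : Exp a m → Exp a m → Exp a m
  if≤      : Exp a m → Exp a m → Exp a m → Exp a m → Exp a m
  -- in the last argument variable 0 is the head and variable 1 the tail
  caseList : Exp a m → Exp a m → Exp a (suc (suc m)) → Exp a m
  bind     : Exp a m → Exp a (suc m) → Exp a m
  call     : Fun b → Vec (Exp a m) b → Exp a m
  -- recursive call of the function whose body this occurs in
  self     : Vec (Exp a m) a → Exp a m

-- f , ρ ⊢ e ⇓ v ⟨ t ⟩ : inside the function f, under the environment ρ,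
-- the expression e evaluates to v in t steps.

infix 3 _,_⊢_⇓_⟨_⟩ _,_⊢*_⇓_⟨_⟩ _·_⇓_⟨_⟩

data _,_⊢_⇓_⟨_⟩ (f : Fun a) (ρ : Vec Val m) : Exp a m → Val → ℕ → Set
data _,_⊢*_⇓_⟨_⟩ (f : Fun a) (ρ : Vec Val m) :
  Vec (Exp a m) b → Vec Val b → ℕ → Set
data _·_⇓_⟨_⟩ : Fun a → Vec Val a → Val → ℕ → Set

data _,_⊢_⇓_⟨_⟩ {a} {m} f ρ where
  var : ∀ {x} → f , ρ ⊢ var x ⇓ Vec.lookup ρ x ⟨ 1 ⟩

  lit : ∀ {i} → f , ρ ⊢ lit i ⇓ num i ⟨ 1 ⟩

  nil : f , ρ ⊢ nil ⇓ nil ⟨ 1 ⟩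

  cons : ∀ {p q v w s t} →
    f , ρ ⊢ p ⇓ v ⟨ s ⟩ → f , ρ ⊢ q ⇓ w ⟨ t ⟩ →
    f , ρ ⊢ cons p q ⇓ cons v w ⟨ 1 + s + t ⟩

  add : ∀ {p q i j s t} →
    f , ρ ⊢ p ⇓ num i ⟨ s ⟩ → f , ρ ⊢ q ⇓ num j ⟨ t ⟩ →
    f , ρ ⊢ add p q ⇓ num (i + j) ⟨ 1 + s + t ⟩

  monus : ∀ {p q i j s t} →
    f , ρ ⊢ p ⇓ num i ⟨ s ⟩ → f , ρ ⊢ q ⇓ num j ⟨ t ⟩ →
    f , ρ ⊢ monus p q ⇓ num (i ∸ j) ⟨ 1 + s + t ⟩

  if≤-then : ∀ {x y p q i j v r s t} →
    f , ρ ⊢ x ⇓ num i ⟨ r ⟩ → f , ρ ⊢ y ⇓ num j ⟨ s ⟩ →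
    i ≤ j → f , ρ ⊢ p ⇓ v ⟨ t ⟩ →
    f , ρ ⊢ if≤ x y p q ⇓ v ⟨ 1 + r + s + t ⟩

  if≤-else : ∀ {x y p q i j v r s t} →
    f , ρ ⊢ x ⇓ num i ⟨ r ⟩ → f , ρ ⊢ y ⇓ num j ⟨ s ⟩ →
    j < i → f , ρ ⊢ q ⇓ v ⟨ t ⟩ →
    f , ρ ⊢ if≤ x y p q ⇓ v ⟨ 1 + r + s + t ⟩

  case-nil : ∀ {x p q v s t} →
    f , ρ ⊢ x ⇓ nil ⟨ s ⟩ → f , ρ ⊢ p ⇓ v ⟨ t ⟩ →
    f , ρ ⊢ caseList x p q ⇓ v ⟨ 1 + s + t ⟩

  case-cons : ∀ {x p q h l v s t} →
    f , ρ ⊢ x ⇓ cons h l ⟨ s ⟩ → f , h ∷ l ∷ ρ ⊢ q ⇓ v ⟨ t ⟩ →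
    f , ρ ⊢ caseList x p q ⇓ v ⟨ 1 + s + t ⟩

  bind : ∀ {p q v w s t} →
    f , ρ ⊢ p ⇓ v ⟨ s ⟩ → f , v ∷ ρ ⊢ q ⇓ w ⟨ t ⟩ →
    f , ρ ⊢ bind p q ⇓ w ⟨ 1 + s + t ⟩

  call : ∀ {b} {g : Fun b} {ps vs v s t} →
    f , ρ ⊢* ps ⇓ vs ⟨ s ⟩ → g · vs ⇓ v ⟨ t ⟩ →
    f , ρ ⊢ call g ps ⇓ v ⟨ 1 + s + t ⟩

  self : ∀ {ps vs v s t} →
    f , ρ ⊢* ps ⇓ vs ⟨ s ⟩ → f · vs ⇓ v ⟨ t ⟩ →
    f , ρ ⊢ self ps ⇓ v ⟨ 1 + s + t ⟩

data _,_⊢*_⇓_⟨_⟩ {a} {m} f ρ where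
  [] : f , ρ ⊢* [] ⇓ [] ⟨ 0 ⟩

  _∷_ : ∀ {b} {p v} {ps : Vec (Exp a m) b} {vs s t} →
    f , ρ ⊢ p ⇓ v ⟨ s ⟩ → f , ρ ⊢* ps ⇓ vs ⟨ t ⟩ →
    f , ρ ⊢* p ∷ ps ⇓ v ∷ vs ⟨ s + t ⟩

data _·_⇓_⟨_⟩ where
  apply : ∀ {p : Exp a a} {vs v t} →
    fun p , vs ⊢ p ⇓ v ⟨ t ⟩ → fun p · vs ⇓ v ⟨ 1 + t ⟩

list : List Val → Val
list = List.foldr cons nil

vertex : ∀ {n} → Fin n → Val
vertex v = num (toℕ v)

-- The graph is given by its weighted adjacency matrix, as a list of rows;
-- an entry is a list of length at most one.

encodeCommon : Common → List Val
encodeCommon I =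
    list (tabulate λ u → list (tabulate λ v →
      maybe (λ ω → list (num ω ∷ [])) nil (weight u v)))
  ∷ list (tabulateOn depots  (λ d _ → vertex d))
  ∷ list (tabulateOn clients (λ c _ → vertex c))
  ∷ num vehicles
  ∷ []
  where open Common I

encodeLoad : ∀ {I} → Load I → List Val
encodeLoad {I} L =
    num capacity
  ∷ list (tabulateOn (Common.clients I) (λ c c∈C → num (demand c c∈C)))
  ∷ []
  where open Load L

encodeGas : ∀ {I} → Gas I → List Val
encodeGas G = num (Gas.capacity G) ∷ []

-- The second list names the vehicle of each client, the clients being taken
-- in increasing order, as in the input (where the demands follow it too).

encodeRouting : ∀ {I} → Routing I → Val
encodeRouting {I} R = cons
  (list (tabulate λ i → list (List.map vertex (toList (vertices (walk i))))))
  (list (tabulateOn clients (λ c c∈C → vertex (assign c c∈C))))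
  where open Routing R; open Common I; open Walk

record Problem : Set₁ where
  field
    Instance : Set
    common   : Instance → Common
    Feasible : (I : Instance) → Routing (common I) → Set
    encode   : Instance → Val

  Optimal : (I : Instance) → Routing (common I) → Set
  Optimal I R = Feasible I R ×
    (∀ R′ → Feasible I R′ → routingWeight R ≤ routingWeight R′)
    where open Routing

  -- A program must recognise instances without feasible routings.
  data Answer (I : Instance) : Val → Set where
    optimal    : ∀ R → Optimal I R → Answer I (encodeRouting R)
    infeasible : (∀ R → ¬ Feasible I R) → Answer I nil

LoadCVRP : Problem
LoadCVRP = record
  { Instance = Σ Common Load
  ; common   = proj₁
  ; Feasible = λ (_ , L) → Load.WithinLoad L
  ; encode   = λ (I , L) → list (encodeCommon I ++ encodeLoad L)
  }

GasCVRP : Problem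
GasCVRP = record
  { Instance = Σ Common Gas
  ; common   = proj₁
  ; Feasible = λ (_ , G) → Gas.WithinGas G
  ; encode   = λ (I , G) → list (encodeCommon I ++ encodeGas G)
  }

LoadGasCVRP : Problem
LoadGasCVRP = record
  { Instance = Σ[ I ∈ Common ] Load I × Gas I
  ; common   = proj₁
  ; Feasible = λ (_ , L , G) R → Load.WithinLoad L R × Gas.WithinGas G R
  ; encode   = λ (I , L , G) →
                 list (encodeCommon I ++ encodeLoad L ++ encodeGas G)
  }

SolvesWithin : (P : Problem) → Fun 1 → (ℕ → ℕ → ℕ) → Set
SolvesWithin P f T = ∀ I →
  let open Common (common I) in
  ∃[ out ] ∃[ t ] f · encode I ∷ [] ⇓ out ⟨ t ⟩
                × Answer I out
                × t ≤ T ∣ clients ∣ n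
  where open Problem P

-- |C|^O(|C|) · n^O(1).  The factor A matters only for n = 1, as larger n
-- absorb it in n^O(1).  Note that 0 ^ 0 ≡ 1.

SolvableInClientTime : Problem → Set
SolvableInClientTime P = ∃[ f ] ∃[ A ] ∃[ B ] ∃[ D ]
  SolvesWithin P f (λ c n → A * c ^ (B * c) * n ^ D)

{-# OPTIONS --safe #-}

-- Within a route only the order of the stops matters: once it is fixed, the
-- cheapest closed walk concatenates shortest walks between consecutive stops,
-- for the best depot.  These are found by n rounds of Bellman–Ford relaxation,
-- n rounds being enough because an optimal walk between two stops may be taken
-- to be simple.  It remains to try all ways of distributing the clients over
-- ordered routes.  They arise by inserting the clients one by one, at any
-- position of a route or into a new route; with j clients placed there are at
-- most 2 j + 1 ways to insert the next, hence at most (1 + 2 c) ^ c plans,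
-- which is at most 3 c ^ (3 c).

module Submission where

open import Defs
open import Data.Bool.Base using (true; false; T; if_then_else_)
open import Data.Empty using (⊥)
open import Data.Fin using (#_)
open import Data.Fin.Base using (Fin; zero; suc; toℕ; fromℕ<)
open import Data.Fin.Properties using (_≟_; injective⇒≤; toℕ-fromℕ<)
open import Data.Fin.Subset using (Subset; inside; outside; ∣_∣) renaming (_∈_ to _∈ˢ_)
open import Data.Fin.Subset.Properties using (∣p∣≤n)
open import Data.List.Base
  using (List; []; _∷_; _++_; length; lookup; map; concatMap; zipWith; allFin; tabulate; initLast; _∷ʳ′_)
import Data.List.Membership.DecPropositional as DecMembership
open import Data.List.Membership.Propositional using (_∈_; find; lose)
open import Data.List.Membership.Propositional.Properties
  using (∈-lookup; ∈-∃++; ∈-++⁺ˡ; ∈-++⁺ʳ; ∈-map⁺; ∈-concatMap⁺; ∈-allFin)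
open import Data.List.NonEmpty.Base as List⁺ using (_∷_; toList)
open import Data.List.Properties
  using (length-map; length-++; length-tabulate; map-++; map-tabulate; tabulate-cong)
open import Data.List.Relation.Binary.Permutation.Propositional using (_↭_; ↭-refl; ↭-sym; ↭-trans; prep)
open import Data.List.Relation.Binary.Permutation.Propositional.Properties using (shift; ∈-resp-↭; map⁺; ↭-length)
open import Data.List.Relation.Binary.Pointwise as Pointwise using (Pointwise; []; _∷_)
open import Data.List.Relation.Unary.All as All using (All; []; _∷_)
import Data.List.Relation.Unary.All.Properties as All
open import Data.List.Relation.Unary.AllPairs using ([]; _∷_)
open import Data.List.Relation.Unary.Any using (Any; here; there)
open import Data.List.Relation.Unary.Linked using (Linked; [-]; _∷_)
open import Data.List.Relation.Unary.Unique.Propositional using (Unique)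
open import Data.Maybe.Base using (Maybe; just; nothing; maybe)
import Data.Maybe.Relation.Unary.All as Maybe
open import Data.Nat.Base
open import Data.Nat.ListAction using (sum)
open import Data.Nat.ListAction.Properties using (sum-++; sum-↭)
open import Data.Nat.Properties hiding (_≟_)
open import Data.Nat.Solver using (module +-*-Solver)
open import Data.Product.Base using (Σ-syntax; ∃-syntax; _×_; _,_; proj₁; proj₂)
open import Data.Unit.Base using (⊤; tt)
open import Data.Vec.Base as Vec using (Vec; []; _∷_; here; there)
open import Function.Base using (_∘_; _$_)
open import Relation.Binary.PropositionalEquality
open import Relation.Nullary.Decidable using (dec-true)
open import Relation.Nullary.Decidable.Core using (True; yes; no; does)
open import Relation.Nullary.Negation.Core using (contradiction)
open +-*-Solver using (solve; _:+_; _:*_; _:=_; con)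

-- Costs are claims about a step-counting semantics, yet no derivation is built by hand. No
-- subexpression of a function body is evaluated twice, so one activation costs at most the size of
-- the body plus the costs of its calls; a weakest-precondition calculus leaves only the calls to be
-- discussed. Costs compose as polynomials in n and a bound M on the number of plans. Inserting the
-- value of M at the end is harmless: a fixed power of c ^ (3 c) only changes the constant in the
-- exponent.
--
-- Correctness never compares two optimal objects. It suffices that whatever the search returns
-- comes from a feasible routing of the stated weight, and that for every feasible routing something
-- no heavier is found; for the latter the walks of that routing themselves compete in the search.
-- The obstacle is bookkeeping: plans number their routes in the order in which they are opened,
-- while a routing numbers its vehicles arbitrarily and may leave some idle. Routes are therefore
-- matched with vehicles only up to a permutation, and idle vehicles are dropped.

private
  variable
    a b n m w : ℕ
    X Y Z : Set
    P : ℕ → X → Set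

-- Upper bounds on running times

infix 3 _·_⇓≤_⟨_⟩

_·_⇓≤_⟨_⟩ : Fun a → Vec Val a → Val → ℕ → Set
f · vs ⇓≤ v ⟨ T ⟩ = ∃[ t ] (f · vs ⇓ v ⟨ t ⟩) × t ≤ T

⇓≤-mono : ∀ {f : Fun a} {vs v S T} → S ≤ T → f · vs ⇓≤ v ⟨ S ⟩ → f · vs ⇓≤ v ⟨ T ⟩
⇓≤-mono S≤T (t , d , t≤S) = t , d , ≤-trans t≤S S≤T

body : Fun a → Exp a a
body (fun e) = e

size  : Exp a m → ℕ
size* : Vec (Exp a m) b → ℕ
size (var x)          = 1
size (lit i)          = 1
size nil              = 1
size (cons p q)       = 1 + size p + size q
size (add p q)        = 1 + size p + size q
size (monus p q)      = 1 + size p + size q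
size (if≤ x y p q)    = 1 + size x + size y + (size p + size q)
size (caseList x p q) = 1 + size x + (size p + size q)
size (bind p q)       = 1 + size p + size q
size (call g ps)      = 1 + size* ps
size (self ps)        = 1 + size* ps
size* []       = 0
size* (p ∷ ps) = size p + size* ps

-- Opaque, lest the type checker compute with unary numerals.
opaque
  overhead : Fun a → ℕ
  overhead f = 1 + size (body f)

-- A value of the wrong shape makes the precondition empty, so proving a precondition includes
-- proving that evaluation never gets stuck.
onNum : Val → (ℕ → Set) → Set
onNum (num i)    P = P i
onNum nil        P = ⊥
onNum (cons _ _) P = ⊥

onList : Val → Set → (Val → Val → Set) → Set
onList (num _)    P Q = ⊥
onList nil        P Q = P
onList (cons h l) P Q = Q h l

-- Weakest preconditions.  The accumulators add up the costs of the calls of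
-- other functions and of the recursive calls; all other steps are accounted
-- for by the size of the expression, as no subexpression is evaluated twice.

wp  : Fun a → Exp a m → Vec Val m → ℕ → ℕ → (Val → ℕ → ℕ → Set) → Set
wp* : Fun a → Vec (Exp a m) b → Vec Val m → ℕ → ℕ → (Vec Val b → ℕ → ℕ → Set) → Set
wp f (var x)          ρ c s Q = Q (Vec.lookup ρ x) c s
wp f (lit i)          ρ c s Q = Q (num i) c s
wp f nil              ρ c s Q = Q nil c s
wp f (cons p q)       ρ c s Q = wp f p ρ c s λ v c s → wp f q ρ c s λ w → Q (cons v w)
wp f (add p q)        ρ c s Q =
  wp f p ρ c s λ v c s → wp f q ρ c s λ w c s → onNum v λ i → onNum w λ j → Q (num (i + j)) c s
wp f (monus p q)      ρ c s Q =
  wp f p ρ c s λ v c s → wp f q ρ c s λ w c s → onNum v λ i → onNum w λ j → Q (num (i ∸ j)) c s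
wp f (if≤ x y p q)    ρ c s Q =
  wp f x ρ c s λ v c s → wp f y ρ c s λ w c s → onNum v λ i → onNum w λ j →
    (i ≤ j → wp f p ρ c s Q) × (j < i → wp f q ρ c s Q)
wp f (caseList x p q) ρ c s Q =
  wp f x ρ c s λ v c s → onList v (wp f p ρ c s Q) λ h l → wp f q (h ∷ l ∷ ρ) c s Q
wp f (bind p q)       ρ c s Q = wp f p ρ c s λ v c s → wp f q (v ∷ ρ) c s Q
wp f (call g ps)      ρ c s Q =
  wp* f ps ρ c s λ vs c s → Σ[ v ∈ Val ] Σ[ t ∈ ℕ ] (g · vs ⇓≤ v ⟨ t ⟩) × Q v (c + t) s
wp f (self ps)        ρ c s Q =
  wp* f ps ρ c s λ vs c s → Σ[ v ∈ Val ] Σ[ t ∈ ℕ ] (f · vs ⇓≤ v ⟨ t ⟩) × Q v c (s + t)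
wp* f []       ρ c s Q = Q [] c s
wp* f (p ∷ ps) ρ c s Q = wp f p ρ c s λ v c s → wp* f ps ρ c s λ vs → Q (v ∷ vs)

-- t steps, raising the cost of calls from c to c′, are paid for by the size S.
record Paid (t c S c′ : ℕ) : Set where
  constructor paid
  field proof : t + c ≤ S + c′

private
  paid₁ : ∀ {c} → Paid 1 c 1 c
  paid₁ = paid ≤-refl

  paid-+ : ∀ {s t c c′ c″ S T} → Paid s c S c′ → Paid t c′ T c″ → Paid (s + t) c (S + T) c″
  paid-+ {s} {t} {c} {c′} {c″} {S} {T} (paid p) (paid q) = paid $ begin
    s + t + c     ≡⟨ solve 3 (λ s t c → s :+ t :+ c := t :+ (s :+ c)) refl s t c ⟩
    t + (s + c)   ≤⟨ +-monoʳ-≤ t p ⟩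
    t + (S + c′)  ≡⟨ solve 3 (λ t S c → t :+ (S :+ c) := S :+ (t :+ c)) refl t S c′ ⟩
    S + (t + c′)  ≤⟨ +-monoʳ-≤ S q ⟩
    S + (T + c″)  ≡⟨ +-assoc S T c″ ⟨
    S + T + c″    ∎
    where open ≤-Reasoning

  paid-call : ∀ {s c S c′ t T} → Paid s c S c′ → t ≤ T → Paid (s + t) c S (c′ + T)
  paid-call {s} {c} {S} {c′} {t} {T} (paid p) q = paid $ begin
    s + t + c     ≡⟨ solve 3 (λ s t c → s :+ t :+ c := (s :+ c) :+ t) refl s t c ⟩
    s + c + t     ≤⟨ +-mono-≤ p q ⟩
    S + c′ + T    ≡⟨ +-assoc S c′ T ⟩
    S + (c′ + T)  ∎
    where open ≤-Reasoning

  paid-suc : ∀ {t c S c′} → Paid t c S c′ → Paid (suc t) c (suc S) c′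
  paid-suc (paid p) = paid (s≤s p)

  paid-left : ∀ {t c S c′} T → Paid t c S c′ → Paid t c (S + T) c′
  paid-left {c′ = c′} T (paid p) = paid (≤-trans p (+-monoˡ-≤ c′ (m≤m+n _ T)))

  paid-right : ∀ {t c S c′} T → Paid t c S c′ → Paid t c (T + S) c′
  paid-right {c′ = c′} T (paid p) = paid (≤-trans p (+-monoˡ-≤ c′ (m≤n+m _ T)))

onNum-elim : ∀ v {P : ℕ → Set} → onNum v P → ∃[ i ] v ≡ num i × P i
onNum-elim (num i) p = i , refl , p

Evaluates : Fun a → Exp a m → Vec Val m → ℕ → ℕ → (Val → ℕ → ℕ → Set) → Set
Evaluates f e ρ c s Q = ∃[ v ] ∃[ c′ ] ∃[ s′ ] ∃[ t ]
  Q v c′ s′ × (f , ρ ⊢ e ⇓ v ⟨ t ⟩) × Paid t (c + s) (size e) (c′ + s′)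

Evaluates* : Fun a → Vec (Exp a m) b → Vec Val m → ℕ → ℕ →
             (Vec Val b → ℕ → ℕ → Set) → Set
Evaluates* f ps ρ c s Q = ∃[ vs ] ∃[ c′ ] ∃[ s′ ] ∃[ t ]
  Q vs c′ s′ × (f , ρ ⊢* ps ⇓ vs ⟨ t ⟩) × Paid t (c + s) (size* ps) (c′ + s′)

-- The postcondition of a subexpression is the precondition of what is evaluated next, so the
-- induction follows the order of evaluation. Of two branches only one is run; the size of the other
-- is slack.
wp-sound  : ∀ (f : Fun a) (e : Exp a m) {ρ c s Q} → wp f e ρ c s Q → Evaluates f e ρ c s Q
wp*-sound : ∀ (f : Fun a) (ps : Vec (Exp a m) b) {ρ c s Q} →
            wp* f ps ρ c s Q → Evaluates* f ps ρ c s Q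
wp-sound f (var x) q = _ , _ , _ , _ , q , var , paid₁
wp-sound f (lit i) q = _ , _ , _ , _ , q , lit , paid₁
wp-sound f nil     q = _ , _ , _ , _ , q , nil , paid₁
wp-sound f (cons p q) w with wp-sound f p w
... | _ , _ , _ , _ , w , d , s≤ with wp-sound f q w
... | _ , _ , _ , _ , w , e , t≤ = _ , _ , _ , _ , w , cons d e , paid-suc (paid-+ s≤ t≤)
wp-sound f (add p q) w with wp-sound f p w
... | v , _ , _ , _ , w , d , s≤ with wp-sound f q w
... | v′ , _ , _ , _ , w , e , t≤ with onNum-elim v w
... | _ , refl , w with onNum-elim v′ w
... | _ , refl , w = _ , _ , _ , _ , w , add d e , paid-suc (paid-+ s≤ t≤)
wp-sound f (monus p q) w with wp-sound f p w
... | v , _ , _ , _ , w , d , s≤ with wp-sound f q w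
... | v′ , _ , _ , _ , w , e , t≤ with onNum-elim v w
... | _ , refl , w with onNum-elim v′ w
... | _ , refl , w = _ , _ , _ , _ , w , monus d e , paid-suc (paid-+ s≤ t≤)
wp-sound f (if≤ x y p q) w with wp-sound f x w
... | v , _ , _ , _ , w , dx , r≤ with wp-sound f y w
... | v′ , _ , _ , _ , w , dy , s≤ with onNum-elim v w
... | i , refl , w with onNum-elim v′ w
... | j , refl , w with i ≤? j
... | yes i≤j with wp-sound f p (proj₁ w i≤j)
...   | _ , _ , _ , _ , w , d , t≤ =
  _ , _ , _ , _ , w , if≤-then dx dy i≤j d ,
  paid-suc (paid-+ (paid-+ r≤ s≤) (paid-left (size q) t≤))
wp-sound f (if≤ x y p q) _
    | v , _ , _ , _ , _ , dx , r≤ | v′ , _ , _ , _ , _ , dy , s≤ | i , refl , _ | j , refl , w | no i≰j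
    with wp-sound f q (proj₂ w (≰⇒> i≰j))
...   | _ , _ , _ , _ , w , d , t≤ =
  _ , _ , _ , _ , w , if≤-else dx dy (≰⇒> i≰j) d ,
  paid-suc (paid-+ (paid-+ r≤ s≤) (paid-right (size p) t≤))
wp-sound f (caseList x p q) w with wp-sound f x w
... | nil , _ , _ , _ , w , dx , s≤ with wp-sound f p w
...   | _ , _ , _ , _ , w , d , t≤ =
  _ , _ , _ , _ , w , case-nil dx d ,
  paid-suc (paid-+ s≤ (paid-left (size q) t≤))
wp-sound f (caseList x p q) _ | cons h l , _ , _ , _ , w , dx , s≤ with wp-sound f q w
...   | _ , _ , _ , _ , w , d , t≤ =
  _ , _ , _ , _ , w , case-cons dx d ,
  paid-suc (paid-+ s≤ (paid-right (size p) t≤))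
wp-sound f (bind p q) w with wp-sound f p w
... | _ , _ , _ , _ , w , d , s≤ with wp-sound f q w
... | _ , _ , _ , _ , w , e , t≤ = _ , _ , _ , _ , w , bind d e , paid-suc (paid-+ s≤ t≤)
wp-sound f (call g ps) w with wp*-sound f ps w
... | _ , c′ , s′ , _ , (_ , T , (_ , d , t≤) , w) , ds , s≤ =
  _ , _ , _ , _ , w , call ds d ,
  subst (Paid _ _ _) (solve 3 (λ c s t → c :+ s :+ t := c :+ t :+ s) refl c′ s′ T)
    (paid-suc (paid-call s≤ t≤))
wp-sound f (self ps) w with wp*-sound f ps w
... | _ , c′ , s′ , _ , (_ , T , (_ , d , t≤) , w) , ds , s≤ =
  _ , _ , _ , _ , w , self ds d ,
  subst (Paid _ _ _) (+-assoc c′ s′ T) (paid-suc (paid-call s≤ t≤))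
wp*-sound f [] w = _ , _ , _ , _ , w , [] , paid ≤-refl
wp*-sound f (p ∷ ps) w with wp-sound f p w
... | _ , _ , _ , _ , w , d , s≤ with wp*-sound f ps w
... | _ , _ , _ , _ , w , ds , t≤ = _ , _ , _ , _ , w , d ∷ ds , paid-+ s≤ t≤

opaque
  unfolding overhead

  -- B bounds the calls of other functions, R the recursive calls. In a loop R is the bound of the
  -- induction hypothesis, k times `overhead f + B`, and the sum shown here is then by computation
  -- `suc k` times the same.
  run : ∀ (f : Fun a) {vs v} B R →
        wp f (body f) vs 0 0 (λ w c s → w ≡ v × c ≤ B × s ≤ R) →
        f · vs ⇓≤ v ⟨ overhead f + B + R ⟩
  run (fun e) B R w with wp-sound (fun e) e w
  ... | _ , c , s , t , (refl , c≤B , s≤R) , d , paid t≤ = 1 + t , apply d , s≤s (begin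
    t                 ≡⟨ +-identityʳ t ⟨
    t + 0             ≤⟨ t≤ ⟩
    size e + (c + s)  ≤⟨ +-monoʳ-≤ (size e) (+-mono-≤ c≤B s≤R) ⟩
    size e + (B + R)  ≡⟨ +-assoc (size e) B R ⟨
    size e + B + R    ∎)
    where open ≤-Reasoning

-- Polynomial cost bounds

infixl 6 _⊕_
infixl 7 _⊗_

-- The variables stand for the number of vertices and for a bound on the number
-- of plans.

data Poly : Set where
  ‵_      : ℕ → Poly
  𝕟 𝕄     : Poly
  _⊕_ _⊗_ : Poly → Poly → Poly

⟦_⟧ : Poly → ℕ → ℕ → ℕ
⟦ ‵ k ⟧   n M = k
⟦ 𝕟 ⟧     n M = n
⟦ 𝕄 ⟧     n M = M
⟦ p ⊕ q ⟧ n M = ⟦ p ⟧ n M + ⟦ q ⟧ n M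
⟦ p ⊗ q ⟧ n M = ⟦ p ⟧ n M * ⟦ q ⟧ n M

private
  ^-distribʳ-* : ∀ m n o → (m * n) ^ o ≡ m ^ o * n ^ o
  ^-distribʳ-* m n zero    = refl
  ^-distribʳ-* m n (suc o) = trans (cong (m * n *_) (^-distribʳ-* m n o))
    (solve 4 (λ a b x y → (a :* b) :* (x :* y) := (a :* x) :* (b :* y)) refl m n (m ^ o) (n ^ o))

  1≤^ : ∀ {x} d → 1 ≤ x → 1 ≤ x ^ d
  1≤^ {x} d 1≤x = subst (_≤ x ^ d) (^-zeroˡ d) (^-monoˡ-≤ d 1≤x)

  term : ℕ → ℕ → ℕ → ℕ → ℕ → ℕ
  term A D E n M = A * n ^ D * M ^ E

  term-mono : ∀ {A D E D′ E′ n M} → 1 ≤ n → 1 ≤ M → D ≤ D′ → E ≤ E′ →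
              term A D E n M ≤ term A D′ E′ n M
  term-mono {A} {n = suc _} {suc _} _ _ D≤ E≤ =
    *-mono-≤ (*-monoʳ-≤ A (^-monoʳ-≤ _ D≤)) (^-monoʳ-≤ _ E≤)

-- The exponents are added even for a sum, which avoids maxima; as n and M are positive, raising an
-- exponent cannot decrease a monomial.
poly-bound : ∀ p → ∃[ A ] ∃[ D ] ∃[ E ] ∀ n M → 1 ≤ n → 1 ≤ M → ⟦ p ⟧ n M ≤ A * n ^ D * M ^ E
poly-bound (‵ k) = k , 0 , 0 , λ n M _ _ →
  ≤-reflexive (sym (trans (*-identityʳ _) (*-identityʳ k)))
poly-bound 𝕟 = 1 , 1 , 0 , λ n M _ _ →
  ≤-reflexive (sym (trans (*-identityʳ _) (trans (*-identityˡ _) (*-identityʳ n))))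
poly-bound 𝕄 = 1 , 0 , 1 , λ n M _ _ →
  ≤-reflexive (sym (trans (*-identityˡ _) (*-identityʳ M)))
poly-bound (p ⊕ q) =
  let A , D , E , p≤ = poly-bound p
      B , F , G , q≤ = poly-bound q
  in A + B , D + F , E + G , λ n M 1≤n 1≤M → begin
    ⟦ p ⟧ n M + ⟦ q ⟧ n M
      ≤⟨ +-mono-≤ (p≤ n M 1≤n 1≤M) (q≤ n M 1≤n 1≤M) ⟩
    term A D E n M + term B F G n M
      ≤⟨ +-mono-≤ (term-mono {A} {D} {E} 1≤n 1≤M (m≤m+n D F) (m≤m+n E G))
                  (term-mono {B} {F} {G} 1≤n 1≤M (m≤n+m F D) (m≤n+m G E)) ⟩
    term A (D + F) (E + G) n M + term B (D + F) (E + G) n M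
      ≡⟨ *-distribʳ-+ (M ^ (E + G)) (A * n ^ (D + F)) _ ⟨
    (A * n ^ (D + F) + B * n ^ (D + F)) * M ^ (E + G)
      ≡⟨ cong (_* M ^ (E + G)) (*-distribʳ-+ (n ^ (D + F)) A B) ⟨
    term (A + B) (D + F) (E + G) n M ∎
  where open ≤-Reasoning
poly-bound (p ⊗ q) =
  let A , D , E , p≤ = poly-bound p
      B , F , G , q≤ = poly-bound q
  in A * B , D + F , E + G , λ n M 1≤n 1≤M → begin
    ⟦ p ⟧ n M * ⟦ q ⟧ n M
      ≤⟨ *-mono-≤ (p≤ n M 1≤n 1≤M) (q≤ n M 1≤n 1≤M) ⟩
    term A D E n M * term B F G n M
      ≡⟨ solve 6 (λ a x y b z w → (a :* x :* y) :* (b :* z :* w) := (a :* b) :* (x :* z) :* (y :* w))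
           refl A (n ^ D) (M ^ E) B (n ^ F) (M ^ G) ⟩
    (A * B) * (n ^ D * n ^ F) * (M ^ E * M ^ G)
      ≡⟨ cong₂ (λ x y → A * B * x * y) (^-distribˡ-+-* n D F) (^-distribˡ-+-* M E G) ⟨
    term (A * B) (D + F) (E + G) n M ∎
  where open ≤-Reasoning

-- For c at least 2 already 1 + 2 c ≤ c ^ 3, whence the exponent 3 c. The factor 3 comes from c = 1,
-- where powers of c stay 1 and both sides equal 3.
plans≤ : ∀ c → (1 + 2 * c) ^ c ≤ 3 * c ^ (3 * c)
plans≤ 0 = s≤s z≤n
plans≤ 1 = ≤-refl
plans≤ c@(suc (suc k)) = begin
  (1 + 2 * c) ^ c    ≤⟨ ^-monoˡ-≤ c 1+2c≤c³ ⟩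
  (c ^ 3) ^ c        ≡⟨ ^-*-assoc c 3 c ⟩
  c ^ (3 * c)        ≤⟨ m≤m+n _ _ ⟩
  3 * c ^ (3 * c)    ∎
  where
  open ≤-Reasoning
  2≤c : 2 ≤ c
  2≤c = s≤s (s≤s z≤n)
  1+2c≤c³ : 1 + 2 * c ≤ c ^ 3
  1+2c≤c³ = begin
    1 + 2 * c          ≤⟨ +-monoˡ-≤ (2 * c) {1} {c} (s≤s z≤n) ⟩
    c + 2 * c          ≤⟨ *-monoˡ-≤ c {3} {4} (s≤s (s≤s (s≤s z≤n))) ⟩
    4 * c              ≤⟨ *-monoˡ-≤ c (*-mono-≤ 2≤c 2≤c) ⟩
    c * c * c          ≡⟨ *-assoc c c c ⟩
    c * (c * c)        ≡⟨ cong (λ x → c * (c * x)) (*-identityʳ c) ⟨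
    c ^ 3              ∎

-- A factor M ^ E becomes 3 ^ E times c ^ (3 E c): the former joins the constant A, the latter fixes
-- B as 3 E.
poly-plans-bound : ∀ p → ∃[ A ] ∃[ B ] ∃[ D ] ∀ c n → 1 ≤ n →
                   ⟦ p ⟧ n ((1 + 2 * c) ^ c) ≤ A * c ^ (B * c) * n ^ D
poly-plans-bound p =
  let A , D , E , p≤ = poly-bound p
  in A * 3 ^ E , 3 * E , D , λ c n 1≤n → begin
    ⟦ p ⟧ n ((1 + 2 * c) ^ c)
      ≤⟨ p≤ n _ 1≤n (1≤^ c (s≤s z≤n)) ⟩
    A * n ^ D * ((1 + 2 * c) ^ c) ^ E
      ≤⟨ *-monoʳ-≤ (A * n ^ D) (^-monoˡ-≤ E (plans≤ c)) ⟩
    A * n ^ D * (3 * c ^ (3 * c)) ^ E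
      ≡⟨ cong (A * n ^ D *_) (trans (^-distribʳ-* 3 (c ^ (3 * c)) E)
           (cong (3 ^ E *_) (trans (^-*-assoc c (3 * c) E) (cong (c ^_)
             (trans (*-assoc 3 c E) (trans (cong (3 *_) (*-comm c E)) (sym (*-assoc 3 E c)))))))) ⟩
    A * n ^ D * (3 ^ E * c ^ (3 * E * c))
      ≡⟨ solve 4 (λ a x y z → a :* x :* (y :* z) := a :* y :* z :* x)
           refl A (n ^ D) (3 ^ E) (c ^ (3 * E * c)) ⟩
    A * 3 ^ E * c ^ (3 * E * c) * n ^ D ∎
  where open ≤-Reasoning

-- The algorithm

-- `nothing` plays the part of infinite weight.
Best : Set → Set
Best X = Maybe (ℕ × X)

Matrix : ℕ → Set
Matrix n = Fin n → Fin n → Maybe ℕ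

Path Route : ℕ → Set
Path n  = List (Fin n)
-- clients with their demands
Route n = List (Fin n × ℕ)

-- A plan consists of the route numbers of the clients and of the routes.
Plan : ℕ → Set
Plan n = List ℕ × List (Route n)

better : Best X → Best X → Best X
better nothing          e                = e
better (just (w , x))   nothing          = just (w , x)
better (just (w , x))   (just (w′ , x′)) =
  if w ≤ᵇ w′ then just (w , x) else just (w′ , x′)

prepend : Fin n → Maybe ℕ → Best (Path n) → Best (Path n)
prepend v nothing  e              = nothing
prepend v (just ω) nothing        = nothing
prepend v (just ω) (just (w , p)) = just (ω + w , v ∷ p)

bestStep : Fin n → (Fin m → Maybe ℕ) → (Fin m → Best (Path n)) → Best (Path n)
bestStep {m = zero}  v r σ = nothing
bestStep {m = suc m} v r σ =
  better (prepend v (r zero) (σ zero)) (bestStep v (r ∘ suc) (σ ∘ suc))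

-- All labels are updated from the same old σ. The old label of v remains a candidate, so k rounds
-- cover the walks of at most k edges rather than of exactly k.
relax : Matrix n → (Fin n → Best (Path n)) → Fin n → Best (Path n)
relax W σ v = better (σ v) (bestStep v (W v) σ)

relaxTimes : ℕ → Matrix n → (Fin n → Best (Path n)) → Fin n → Best (Path n)
relaxTimes zero    W σ = σ
relaxTimes (suc k) W σ = relax W (relaxTimes k W σ)

-- The initial labels, finite at most at position s. Once e is placed, the recursion goes on by
-- placing `nothing` at position 0 of the rest; this is the form in which `placeF` runs through the
-- list.
place : ℕ → Best X → Fin m → Best X
place zero    e zero    = e
place zero    e (suc j) = place zero nothing j
place (suc s) e zero    = nothing
place (suc s) e (suc j) = place s e j

-- The initial label at s is the whole partial tour from s onwards, so relaxation directly extends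
-- this tour backwards to t.
hop : Matrix n → Fin n → Fin n → Best (Path n) → Best (Path n)
hop {n} W s t e = relaxTimes n W (place (toℕ s) e) t

-- The walk from t through the stops to d is built from its end, because relaxation prepends
-- vertices. A closed tour is the case t = d.
reach : Matrix n → Fin n → Fin n → Route n → Best (Path n)
reach W d t []            = hop W d t (just (0 , d ∷ []))
reach W d t ((c , _) ∷ r) = hop W c t (reach W d c r)

bestTour : Matrix n → List (Fin n) → Route n → Best (Path n)
bestTour W []       r = nothing
bestTour W (d ∷ ds) r = better (reach W d d r) (bestTour W ds r)

load : Route n → ℕ
load []            = 0
load ((_ , δ) ∷ r) = δ + load r

within : Maybe ℕ → Best X → Best X
within nothing  e              = e
within (just g) nothing        = nothing
within (just g) (just (w , x)) = if w ≤ᵇ g then just (w , x) else nothing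

tour : Matrix n → List (Fin n) → ℕ → Maybe ℕ → Route n → Best (Path n)
tour W D ℓ g r = if load r ≤ᵇ ℓ then within g (bestTour W D r) else nothing

addTour : Best X → Best (List X) → Best (List X)
addTour nothing        E               = nothing
addTour (just (w , x)) nothing         = nothing
addTour (just (w , x)) (just (W , xs)) = just (w + W , x ∷ xs)

tours : Matrix n → List (Fin n) → ℕ → Maybe ℕ → List (Route n) → Best (List (Path n))
tours W D ℓ g []       = just (0 , [])
tours W D ℓ g (r ∷ rs) = addTour (tour W D ℓ g r) (tours W D ℓ g rs)

Solution : ℕ → Set
Solution n = List (Path n) × List ℕ

label : List ℕ → Best (List (Path n)) → Best (Solution n)
label as nothing         = nothing
label as (just (W , ps)) = just (W , ps , as)

evaluate : Matrix n → List (Fin n) → ℕ → ℕ → Maybe ℕ → Plan n → Best (Solution n)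
evaluate W D k ℓ g (as , rs) =
  if length rs ≤ᵇ k then label as (tours W D ℓ g rs) else nothing

bestPlan : Matrix n → List (Fin n) → ℕ → ℕ → Maybe ℕ → List (Plan n) → Best (Solution n)
bestPlan W D k ℓ g []       = nothing
bestPlan W D k ℓ g (x ∷ xs) = better (evaluate W D k ℓ g x) (bestPlan W D k ℓ g xs)

insertions : X → List X → List (List X)
insertions x []       = (x ∷ []) ∷ []
insertions x (y ∷ ys) = (x ∷ y ∷ ys) ∷ map (y ∷_) (insertions x ys)

-- A new route is opened only behind all existing ones, so the route numbers given to earlier
-- clients remain valid.
placements : X → List (List X) → List (ℕ × List (List X))
placements x []       = (0 , (x ∷ []) ∷ []) ∷ []
placements x (r ∷ rs) =
  map (λ r′ → 0 , r′ ∷ rs) (insertions x r) ++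
  map (λ (i , rs′) → suc i , r ∷ rs′) (placements x rs)

addClient : Fin n × ℕ → Plan n → List (Plan n)
addClient x (as , rs) = map (λ (i , rs′) → i ∷ as , rs′) (placements x rs)

plans : List (Fin n × ℕ) → List (Plan n)
plans []       = ([] , []) ∷ []
plans (x ∷ xs) = concatMap (addClient x) (plans xs)

optimum : Matrix n → List (Fin n) → List (Fin n × ℕ) → ℕ → ℕ → Maybe ℕ → Best (Solution n)
optimum W D items k ℓ g = bestPlan W D k ℓ g (plans items)

-- The number of plans

-- The number of insertion points in existing routes: one more than the length for each route.
room : List (List X) → ℕ
room []       = 0
room (r ∷ rs) = suc (length r) + room rs

length≤room : (rs : List (List X)) → length rs ≤ room rs
length≤room []       = z≤n
length≤room (r ∷ rs) = s≤s (≤-trans (length≤room rs) (m≤n+m (room rs) (length r)))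

length-insertions : ∀ (x : X) r → length (insertions x r) ≡ suc (length r)
length-insertions x []      = refl
length-insertions x (y ∷ r) = cong suc (trans (length-map _ (insertions x r)) (length-insertions x r))

length-placements : ∀ (x : X) rs → length (placements x rs) ≡ suc (room rs)
length-placements x []       = refl
length-placements x (r ∷ rs) = begin
  length (placements x (r ∷ rs))
    ≡⟨ length-++ (map _ (insertions x r)) ⟩
  length (map _ (insertions x r)) + length (map _ (placements x rs))
    ≡⟨ cong₂ _+_ (trans (length-map _ (insertions x r)) (length-insertions x r))
                 (trans (length-map _ (placements x rs)) (length-placements x rs)) ⟩
  suc (length r) + suc (room rs)
    ≡⟨ +-suc (suc (length r)) (room rs) ⟩
  suc (room (r ∷ rs)) ∎
  where open ≡-Reasoning

insertions-length : ∀ (x : X) r → All (λ r′ → length r′ ≡ suc (length r)) (insertions x r)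
insertions-length x []      = refl ∷ []
insertions-length x (y ∷ r) = refl ∷ All.map⁺ (All.map (cong suc) (insertions-length x r))

-- Lengthening a route adds one insertion point; opening a new route, of length one, adds two.
placements-room : ∀ (x : X) rs → All (λ (i , rs′) → room rs′ ≤ 2 + room rs) (placements x rs)
placements-room x []       = ≤-refl ∷ []
placements-room x (r ∷ rs) = All.++⁺
  (All.map⁺ (All.map (λ eq → subst (λ l → suc l + room rs ≤ 2 + room (r ∷ rs)) (sym eq) (n≤1+n _))
    (insertions-length x r)))
  (All.map⁺ (All.map (λ {(i , rs′)} le → begin
      suc (length r) + room rs′        ≤⟨ +-monoʳ-≤ (suc (length r)) le ⟩
      suc (length r) + (2 + room rs)   ≡⟨ solve 2 (λ l s → l :+ (con 2 :+ s) := con 2 :+ (l :+ s))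
                                            refl (suc (length r)) (room rs) ⟩
      2 + room (r ∷ rs)                ∎)
    (placements-room x rs)))
  where open ≤-Reasoning

plans-room : (xs : Route n) → All (λ (as , rs) → room rs ≤ 2 * length xs) (plans xs)
plans-room []       = z≤n ∷ []
plans-room (x ∷ xs) = All.concat⁺ (All.map⁺ (All.map (λ {(as , rs)} le →
    All.map⁺ (All.map (λ le′ → ≤-trans le′ (begin
        2 + room rs         ≤⟨ +-monoʳ-≤ 2 le ⟩
        2 + 2 * length xs   ≡⟨ *-suc 2 (length xs) ⟨
        2 * length (x ∷ xs) ∎))
      (placements-room x rs)))
  (plans-room xs)))
  where open ≤-Reasoning

length-concatMap : ∀ (f : X → List Y) b {xs} → All (λ x → length (f x) ≤ b) xs →
                   length (concatMap f xs) ≤ b * length xs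
length-concatMap f b []                   = z≤n
length-concatMap f b {x ∷ xs} (px ∷ pxs) = begin
  length (f x ++ concatMap f xs)          ≡⟨ length-++ (f x) ⟩
  length (f x) + length (concatMap f xs)  ≤⟨ +-mono-≤ px (length-concatMap f b pxs) ⟩
  b + b * length xs                       ≡⟨ *-suc b (length xs) ⟨
  b * suc (length xs)                     ∎
  where open ≤-Reasoning

length-addClient : ∀ x (p : Plan n) → length (addClient x p) ≡ suc (room (proj₂ p))
length-addClient x (as , rs) = trans (length-map _ (placements x rs)) (length-placements x rs)

-- The number of choices at every insertion is bounded by the same 1 + 2 c; hence c is kept fixed
-- while the list shrinks in the induction.
length-plans : ∀ c (xs : Route n) → length xs ≤ c → length (plans xs) ≤ (1 + 2 * c) ^ length xs
length-plans c []       _   = ≤-refl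
length-plans c (x ∷ xs) lt = ≤-trans
  (length-concatMap (addClient x) (1 + 2 * c)
    (All.map (λ {p} le → ≤-trans (≤-reflexive (length-addClient x p))
                           (s≤s (≤-trans le (*-monoʳ-≤ 2 xs≤c))))
      (plans-room xs)))
  (*-monoʳ-≤ (1 + 2 * c) (length-plans c xs xs≤c))
  where xs≤c = <⇒≤ lt

-- Programs

-- De Bruijn indices: `caseList` shifts the older variables by two and `bind` by one, so an argument
-- changes its number from branch to branch.
v : ∀ i {m} {i<m : True (i <? m)} → Exp a m
v i {i<m = i<m} = var ((# i) {m<n = i<m})

betterF withinF addTourF labelF getF appendF insertionsF placementsF addClientF expandF : Fun 2
prependF bestStepF relaxTimesF placeF bestTourF : Fun 3
relaxF hopF reachF : Fun 4
loadF lengthF plansF : Fun 1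
tourF toursF : Fun 5
evaluateF bestPlanF optimumF : Fun 6

betterF = fun
  (caseList (v 0) (v 1)
  (caseList (v 3) (v 2)
  (if≤ (v 2) (v 0) (v 4) (v 5))))

prependF = fun
  (caseList (v 1) nil
  (caseList (v 4) nil
  (cons (add (v 2) (v 0)) (cons (v 4) (v 1)))))

bestStepF = fun
  (caseList (v 1) nil
  (caseList (v 4) nil
  (call betterF (call prependF (v 4 ∷ v 2 ∷ v 0 ∷ []) ∷ self (v 4 ∷ v 3 ∷ v 1 ∷ []) ∷ []))))

-- The first argument numbers the current vertex. The third is the list of labels still to be
-- updated, whereas the fourth keeps the complete list of old labels.
relaxF = fun
  (caseList (v 1) nil
  (caseList (v 4) nil
  (cons (call betterF (v 0 ∷ call bestStepF (v 4 ∷ v 2 ∷ v 7 ∷ []) ∷ []))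
        (self (add (lit 1) (v 4) ∷ v 3 ∷ v 1 ∷ v 7 ∷ [])))))

-- The first argument is a list serving as a unary counter, as is the last
-- argument of placeF.
relaxTimesF = fun
  (caseList (v 0) (v 2)
  (bind (self (v 1 ∷ v 3 ∷ v 4 ∷ []))
  (call relaxF (lit 0 ∷ v 4 ∷ v 0 ∷ v 0 ∷ []))))

placeF = fun
  (caseList (v 2) nil
  (if≤ (v 2) (lit 0)
    (cons (v 3) (self (lit 0 ∷ nil ∷ v 1 ∷ [])))
    (cons nil (self (monus (v 2) (lit 1) ∷ v 3 ∷ v 1 ∷ [])))))

getF = fun
  (caseList (v 1) nil
  (if≤ (v 2) (lit 0) (v 0) (self (monus (v 2) (lit 1) ∷ v 1 ∷ []))))

-- The matrix, having n rows, doubles as the unary counter for `placeF` and `relaxTimesF`.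
hopF = fun
  (call getF (v 2 ∷ call relaxTimesF (v 0 ∷ v 0 ∷ call placeF (v 1 ∷ v 3 ∷ v 0 ∷ []) ∷ []) ∷ []))

reachF = fun
  (caseList (v 3) (call hopF (v 0 ∷ v 1 ∷ v 2 ∷ cons (lit 0) (cons (v 1) nil) ∷ []))
  (caseList (v 0) nil
  (call hopF (v 4 ∷ v 0 ∷ v 6 ∷ self (v 4 ∷ v 5 ∷ v 0 ∷ v 3 ∷ []) ∷ []))))

bestTourF = fun
  (caseList (v 1) nil
  (call betterF (call reachF (v 2 ∷ v 0 ∷ v 0 ∷ v 4 ∷ []) ∷ self (v 2 ∷ v 1 ∷ v 4 ∷ []) ∷ [])))

loadF = fun
  (caseList (v 0) (lit 0)
  (caseList (v 0) nil
  (add (v 1) (self (v 3 ∷ [])))))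

withinF = fun
  (caseList (v 0) (v 1)
  (caseList (v 3) nil
  (if≤ (v 0) (v 2) (v 5) nil)))

tourF = fun
  (if≤ (call loadF (v 4 ∷ [])) (v 2)
    (call withinF (v 3 ∷ call bestTourF (v 0 ∷ v 1 ∷ v 4 ∷ []) ∷ []))
    nil)

addTourF = fun
  (caseList (v 0) nil
  (caseList (v 3) nil
  (cons (add (v 2) (v 0)) (cons (v 3) (v 1)))))

toursF = fun
  (caseList (v 4) (cons (lit 0) nil)
  (call addTourF
    ( call tourF (v 2 ∷ v 3 ∷ v 4 ∷ v 5 ∷ v 0 ∷ [])
    ∷ self (v 2 ∷ v 3 ∷ v 4 ∷ v 5 ∷ v 1 ∷ []) ∷ [])))

lengthF = fun
  (caseList (v 0) (lit 0)
  (add (lit 1) (self (v 1 ∷ []))))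

labelF = fun
  (caseList (v 1) nil
  (cons (v 0) (cons (v 1) (v 2))))

evaluateF = fun
  (caseList (v 5) nil
  (if≤ (call lengthF (v 1 ∷ [])) (v 4)
    (call labelF (v 0 ∷ call toursF (v 2 ∷ v 3 ∷ v 5 ∷ v 6 ∷ v 1 ∷ []) ∷ []))
    nil))

bestPlanF = fun
  (caseList (v 5) nil
  (call betterF
    ( call evaluateF (v 2 ∷ v 3 ∷ v 4 ∷ v 5 ∷ v 6 ∷ v 0 ∷ [])
    ∷ self (v 2 ∷ v 3 ∷ v 4 ∷ v 5 ∷ v 6 ∷ v 1 ∷ []) ∷ [])))

-- The language is first-order, so a closure is represented by a program `g` and its captured value,
-- the second argument.
mapF : Fun 2 → Fun 2
mapF g = fun
  (caseList (v 0) nil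
  (cons (call g (v 0 ∷ v 3 ∷ [])) (self (v 1 ∷ v 3 ∷ []))))

appendF = fun
  (caseList (v 0) (v 1)
  (cons (v 0) (self (v 1 ∷ v 3 ∷ []))))

consF openF skipF tagF : Fun 2
consF = fun (cons (v 1) (v 0))
openF = fun (cons (lit 0) (cons (v 0) (v 1)))
skipF = fun (caseList (v 0) nil (cons (add (lit 1) (v 0)) (cons (v 3) (v 1))))
tagF  = fun (caseList (v 0) nil (cons (cons (v 0) (v 3)) (v 1)))

insertionsF = fun
  (caseList (v 1) (cons (cons (v 0) nil) nil)
  (cons (cons (v 2) (v 3)) (call (mapF consF) (self (v 2 ∷ v 1 ∷ []) ∷ v 0 ∷ []))))

placementsF = fun
  (caseList (v 1) (cons (cons (lit 0) (cons (cons (v 0) nil) nil)) nil)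
  (call appendF
    ( call (mapF openF) (call insertionsF (v 2 ∷ v 0 ∷ []) ∷ v 1 ∷ [])
    ∷ call (mapF skipF) (self (v 2 ∷ v 1 ∷ []) ∷ v 0 ∷ []) ∷ [])))

addClientF = fun
  (caseList (v 1) nil
  (call (mapF tagF) (call placementsF (v 2 ∷ v 1 ∷ []) ∷ v 0 ∷ [])))

expandF = fun
  (caseList (v 1) nil
  (call appendF (call addClientF (v 2 ∷ v 0 ∷ []) ∷ self (v 2 ∷ v 1 ∷ []) ∷ [])))

plansF = fun
  (caseList (v 0) (cons (cons nil nil) nil)
  (call expandF (v 0 ∷ self (v 1 ∷ []) ∷ [])))

optimumF = fun
  (call bestPlanF (v 0 ∷ v 1 ∷ v 3 ∷ v 4 ∷ v 5 ∷ call plansF (v 2 ∷ []) ∷ []))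

-- Encodings of the data as values

encBest : (X → Val) → Best X → Val
encBest enc nothing        = nil
encBest enc (just (w , x)) = cons (num w) (enc x)

encList : (X → Val) → List X → Val
encList enc xs = list (map enc xs)

encFin : (Fin m → Val) → Val
encFin f = list (tabulate f)

encPath : Path n → Val
encPath = encList vertex

encEntry : Maybe ℕ → Val
encEntry = maybe (λ ω → list (num ω ∷ [])) nil

encMatrix : Matrix n → Val
encMatrix W = encFin λ u → encFin λ v → encEntry (W u v)

encClient : Fin n × ℕ → Val
encClient (c , δ) = cons (vertex c) (num δ)

encRoute : Route n → Val
encRoute = encList encClient

encRoutes : List (Route n) → Val
encRoutes = encList encRoute

encPlan : Plan n → Val
encPlan (as , rs) = cons (encList num as) (encRoutes rs)

encPlacement : (ℕ × List (Route n)) → Val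
encPlacement (i , rs) = cons (num i) (encRoutes rs)

encSolution : Solution n → Val
encSolution (ps , as) = cons (encList encPath ps) (encList num as)

if-≤ : ∀ {i j} {x y : X} → i ≤ j → (if i ≤ᵇ j then x else y) ≡ x
if-≤ {i = i} {j} i≤j with i ≤ᵇ j | ≤⇒≤ᵇ i≤j
... | true | _ = refl

if-> : ∀ {i j} {x y : X} → j < i → (if i ≤ᵇ j then x else y) ≡ y
if-> {i = i} {j} j<i with i ≤ᵇ j in eq
... | false = refl
... | true with () ← <⇒≱ j<i (≤ᵇ⇒≤ i j (subst T (sym eq) _))

better-spec : ∀ {enc : X → Val} e e′ →
  betterF · encBest enc e ∷ encBest enc e′ ∷ [] ⇓≤ encBest enc (better e e′) ⟨ overhead betterF + 0 + 0 ⟩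
better-spec nothing          e′ = run betterF 0 0 (refl , z≤n , z≤n)
better-spec (just (w , x))   nothing = run betterF 0 0 (refl , z≤n , z≤n)
better-spec {enc = enc} (just (w , x)) (just (w′ , x′)) = run betterF 0 0
  ( (λ w≤w′ → cong (encBest enc) (sym (if-≤ w≤w′)) , z≤n , z≤n)
  , (λ w′<w → cong (encBest enc) (sym (if-> w′<w)) , z≤n , z≤n))

prepend-spec : ∀ (u : Fin n) ω e →
  prependF · vertex u ∷ encEntry ω ∷ encBest encPath e ∷ []
    ⇓≤ encBest encPath (prepend u ω e) ⟨ overhead prependF + 0 + 0 ⟩
prepend-spec u nothing  e              = run prependF 0 0 (refl , z≤n , z≤n)
prepend-spec u (just ω) nothing        = run prependF 0 0 (refl , z≤n , z≤n)
prepend-spec u (just ω) (just (w , p)) = run prependF 0 0 (refl , z≤n , z≤n)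

within-spec : ∀ {enc : X → Val} g e →
  withinF · encEntry g ∷ encBest enc e ∷ [] ⇓≤ encBest enc (within g e) ⟨ overhead withinF + 0 + 0 ⟩
within-spec nothing  e       = run withinF 0 0 (refl , z≤n , z≤n)
within-spec (just g) nothing = run withinF 0 0 (refl , z≤n , z≤n)
within-spec {enc = enc} (just g) (just (w , x)) = run withinF 0 0
  ( (λ w≤g → cong (encBest enc) (sym (if-≤ w≤g)) , z≤n , z≤n)
  , (λ g<w → cong (encBest enc) (sym (if-> g<w)) , z≤n , z≤n))

-- The prefix c marks the cost of a function, b that of the calls in its body
-- other than the recursive ones.

cBetter cPrepend cWithin : Poly
cBetter  = ‵ (overhead betterF + 0 + 0)
cPrepend = ‵ (overhead prependF + 0 + 0)
cWithin  = ‵ (overhead withinF + 0 + 0)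

loop : Fun a → Poly → Poly
loop f b = ‵ overhead f ⊕ b

bBestStep bRelax bRelaxTimes bHop bReach bBestTour bTour bTours
  bEvaluate bBestPlan bInsertions bPlacements bAddClient bExpand bPlans bOptimum cBestStep cRelax cRelaxTimes cPlace cGet cHop
  L cLoad cTour cAddTour cLabel cTours cEvaluate cCons cOpen cSkip cTag cInsertions cPlacements
  cAddClient cAppend cExpand cBestPlan cPlans cOptimum : Poly
cMap : Fun 2 → Poly → Poly
-- Each sum lists the calls in the order of evaluation, nested to the left as `wp` accumulates them,
-- so that `≤-refl` usually settles the bound.
bBestStep   = cPrepend ⊕ cBetter
cBestStep   = (‵ 1 ⊕ 𝕟) ⊗ loop bestStepF bBestStep
bRelax      = cBestStep ⊕ cBetter
cRelax      = (‵ 1 ⊕ 𝕟) ⊗ loop relaxF bRelax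
bRelaxTimes = cRelax
cRelaxTimes = (‵ 1 ⊕ 𝕟) ⊗ loop relaxTimesF bRelaxTimes
cPlace      = (‵ 1 ⊕ 𝕟) ⊗ loop placeF (‵ 0)
cGet        = (‵ 1 ⊕ 𝕟) ⊗ loop getF (‵ 0)
bHop        = cPlace ⊕ cRelaxTimes ⊕ cGet
cHop        = ‵ overhead hopF ⊕ bHop ⊕ ‵ 0
bReach      = cHop
-- The routes of a plan have at most 2 n insertion points by `plans-room`; the 2 stands for the
-- placement in a new route and for the last round of a loop, on the empty list.
L           = ‵ 2 ⊕ (𝕟 ⊕ 𝕟)
bBestTour   = L ⊗ loop reachF bReach ⊕ cBetter
cLoad       = L ⊗ loop loadF (‵ 0)
bTour       = cLoad ⊕ (‵ 1 ⊕ 𝕟) ⊗ loop bestTourF bBestTour ⊕ cWithin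
cTour       = ‵ overhead tourF ⊕ bTour ⊕ ‵ 0
cAddTour    = ‵ (overhead addTourF + 0 + 0)
bTours      = cTour ⊕ cAddTour
cTours      = L ⊗ loop toursF bTours
cLabel      = ‵ (overhead labelF + 0 + 0)
bEvaluate   = L ⊗ loop lengthF (‵ 0) ⊕ cTours ⊕ cLabel
cEvaluate   = ‵ overhead evaluateF ⊕ bEvaluate ⊕ ‵ 0
bBestPlan   = cEvaluate ⊕ cBetter
cBestPlan   = (‵ 1 ⊕ 𝕄) ⊗ loop bestPlanF bBestPlan
cMap f c    = L ⊗ loop (mapF f) c
cCons       = ‵ (overhead consF + 0 + 0)
cOpen       = ‵ (overhead openF + 0 + 0)
cSkip       = ‵ (overhead skipF + 0 + 0)
cTag        = ‵ (overhead tagF + 0 + 0)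
bInsertions = cMap consF cCons
cInsertions = L ⊗ loop insertionsF bInsertions
cAppend     = L ⊗ loop appendF (‵ 0)
bPlacements = cInsertions ⊕ cMap openF cOpen ⊕ cMap skipF cSkip ⊕ cAppend
cPlacements = L ⊗ loop placementsF bPlacements
bAddClient  = cPlacements ⊕ cMap tagF cTag
cAddClient  = ‵ overhead addClientF ⊕ bAddClient ⊕ ‵ 0
bExpand     = cAddClient ⊕ cAppend
cExpand     = (‵ 1 ⊕ 𝕄) ⊗ loop expandF bExpand
bPlans      = cExpand
cPlans      = (‵ 1 ⊕ 𝕟) ⊗ loop plansF bPlans
bOptimum    = cPlans ⊕ cBestPlan
cOptimum    = ‵ overhead optimumF ⊕ bOptimum ⊕ ‵ 0

-- Correctness and running times of the programs

module Spec (n M : ℕ) where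

  cost : Poly → ℕ
  cost p = ⟦ p ⟧ n M

  bestStep-spec : ∀ {m} (u : Fin n) (r : Fin m → Maybe ℕ) (σ : Fin m → Best (Path n)) →
    bestStepF · vertex u ∷ encFin (encEntry ∘ r) ∷ encFin (encBest encPath ∘ σ) ∷ []
      ⇓≤ encBest encPath (bestStep u r σ) ⟨ suc m * cost (loop bestStepF bBestStep) ⟩
  bestStep-spec {zero}  u r σ = run bestStepF (cost bBestStep) 0 (refl , z≤n , z≤n)
  bestStep-spec {suc m} u r σ = run bestStepF (cost bBestStep) (suc m * cost (loop bestStepF bBestStep))
    ( _ , _ , prepend-spec u (r zero) (σ zero)
    , _ , _ , bestStep-spec u (r ∘ suc) (σ ∘ suc)
    , _ , _ , better-spec (prepend u (r zero) (σ zero)) (bestStep u (r ∘ suc) (σ ∘ suc))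
    , refl , ≤-refl , ≤-refl)

  -- Stated for the tails on which `relaxF` recurs: position i of a tail belongs to the vertex
  -- `name i`, whose number is k + i, while σ stays complete.
  relax-spec : ∀ {m} k (name : Fin m → Fin n) (R : Fin m → Fin n → Maybe ℕ)
    (τ : Fin m → Best (Path n)) σ → (∀ i → toℕ (name i) ≡ k + toℕ i) →
    relaxF · num k ∷ encFin (λ i → encFin (encEntry ∘ R i)) ∷ encFin (encBest encPath ∘ τ)
           ∷ encFin (encBest encPath ∘ σ) ∷ []
      ⇓≤ encFin (λ i → encBest encPath (better (τ i) (bestStep (name i) (R i) σ)))
         ⟨ suc m * cost (loop relaxF bRelax) ⟩
  relax-spec {zero}  k name R τ σ eq = run relaxF (cost bRelax) 0 (refl , z≤n , z≤n)
  relax-spec {suc m} k name R τ σ eq = run relaxF (cost bRelax) (suc m * cost (loop relaxF bRelax))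
    ( _ , _ , subst (λ u → bestStepF · num u ∷ _ ⇓≤ _ ⟨ _ ⟩) (trans (eq zero) (+-identityʳ k))
                (bestStep-spec (name zero) (R zero) σ)
    , _ , _ , better-spec (τ zero) (bestStep (name zero) (R zero) σ)
    , _ , _ , relax-spec (suc k) (name ∘ suc) (R ∘ suc) (τ ∘ suc) σ
                (λ i → trans (eq (suc i)) (+-suc k (toℕ i)))
    , refl , ≤-refl , ≤-refl)

  relaxTimes-spec : ∀ {m} (counter : Fin m → Val) (W : Matrix n) σ →
    relaxTimesF · encFin counter ∷ encMatrix W ∷ encFin (encBest encPath ∘ σ) ∷ []
      ⇓≤ encFin (encBest encPath ∘ relaxTimes m W σ) ⟨ suc m * cost (loop relaxTimesF bRelaxTimes) ⟩
  relaxTimes-spec {zero}  counter W σ = run relaxTimesF (cost bRelaxTimes) 0 (refl , z≤n , z≤n)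
  relaxTimes-spec {suc m} counter W σ =
    run relaxTimesF (cost bRelaxTimes) (suc m * cost (loop relaxTimesF bRelaxTimes))
    ( _ , _ , relaxTimes-spec (counter ∘ suc) W σ
    , _ , _ , relax-spec 0 (λ i → i) W (relaxTimes m W σ) (relaxTimes m W σ) (λ _ → refl)
    , refl , ≤-refl , ≤-refl)

  place-spec : ∀ {m} (counter : Fin m → Val) s e →
    placeF · num s ∷ encBest encPath e ∷ encFin counter ∷ []
      ⇓≤ encFin {m} (λ j → encBest encPath (place {Path n} s e j)) ⟨ suc m * cost (loop placeF (‵ 0)) ⟩
  place-spec {zero}  counter s       e = run placeF 0 0 (refl , z≤n , z≤n)
  place-spec {suc m} counter zero    e = run placeF 0 (suc m * cost (loop placeF (‵ 0)))
    ( (λ _ → _ , _ , place-spec (counter ∘ suc) 0 nothing , refl , z≤n , ≤-refl)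
    , (λ ()))
  place-spec {suc m} counter (suc s) e = run placeF 0 (suc m * cost (loop placeF (‵ 0)))
    ( (λ ())
    , (λ _ → _ , _ , place-spec (counter ∘ suc) s e , refl , z≤n , ≤-refl))

  get-spec : ∀ {m} (f : Fin m → Val) i →
    getF · vertex i ∷ encFin f ∷ [] ⇓≤ f i ⟨ suc m * cost (loop getF (‵ 0)) ⟩
  get-spec {suc m} f zero    = run getF 0 (suc m * cost (loop getF (‵ 0)))
    ((λ _ → refl , z≤n , z≤n) , (λ ()))
  get-spec {suc m} f (suc i) = run getF 0 (suc m * cost (loop getF (‵ 0)))
    ((λ ()) , (λ _ → _ , _ , get-spec (f ∘ suc) i , refl , z≤n , ≤-refl))

  hop-spec : ∀ (W : Matrix n) s t e →
    hopF · encMatrix W ∷ vertex s ∷ vertex t ∷ encBest encPath e ∷ []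
      ⇓≤ encBest encPath (hop W s t e) ⟨ cost cHop ⟩
  hop-spec W s t e = run hopF (cost bHop) 0
    ( _ , _ , place-spec {n} _ (toℕ s) e
    , _ , _ , relaxTimes-spec {n} _ W (place (toℕ s) e)
    , _ , _ , get-spec (encBest encPath ∘ hop′) t
    , refl , ≤-refl , z≤n)
    where hop′ = relaxTimes n W (place (toℕ s) e)

  reach-spec : ∀ (W : Matrix n) d t r →
    reachF · encMatrix W ∷ vertex d ∷ vertex t ∷ encRoute r ∷ []
      ⇓≤ encBest encPath (reach W d t r) ⟨ suc (length r) * cost (loop reachF bReach) ⟩
  reach-spec W d t []            = run reachF (cost bReach) 0
    (_ , _ , hop-spec W d t (just (0 , d ∷ [])) , refl , ≤-refl , z≤n)
  reach-spec W d t ((c , δ) ∷ r) = run reachF (cost bReach) (suc (length r) * cost (loop reachF bReach))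
    ( _ , _ , reach-spec W d c r
    , _ , _ , hop-spec W c t (reach W d c r)
    , refl , ≤-refl , ≤-refl)

  rounds : ∀ {i j} p → i ≤ j → i * cost p ≤ j * cost p
  rounds p = *-monoˡ-≤ (cost p)

  bestTour-spec : ∀ W ds r → suc (length r) ≤ cost L →
    bestTourF · encMatrix W ∷ encPath ds ∷ encRoute r ∷ []
      ⇓≤ encBest encPath (bestTour W ds r) ⟨ suc (length ds) * cost (loop bestTourF bBestTour) ⟩
  bestTour-spec W []       r r≤ = run bestTourF (cost bBestTour) 0 (refl , z≤n , z≤n)
  bestTour-spec W (d ∷ ds) r r≤ =
    run bestTourF (cost bBestTour) (suc (length ds) * cost (loop bestTourF bBestTour))
    ( _ , _ , ⇓≤-mono (rounds (loop reachF bReach) r≤) (reach-spec W d d r)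
    , _ , _ , bestTour-spec W ds r r≤
    , _ , _ , better-spec (reach W d d r) (bestTour W ds r)
    , refl , ≤-refl , ≤-refl)

  load-spec : ∀ (r : Route n) →
    loadF · encRoute r ∷ [] ⇓≤ num (load r) ⟨ suc (length r) * cost (loop loadF (‵ 0)) ⟩
  load-spec []            = run loadF 0 0 (refl , z≤n , z≤n)
  load-spec ((c , δ) ∷ r) = run loadF 0 (suc (length r) * cost (loop loadF (‵ 0)))
    (_ , _ , load-spec r , refl , z≤n , ≤-refl)

  tour-spec : ∀ W D ℓ g r → length D ≤ n → suc (length r) ≤ cost L →
    tourF · encMatrix W ∷ encPath D ∷ num ℓ ∷ encEntry g ∷ encRoute r ∷ []
      ⇓≤ encBest encPath (tour W D ℓ g r) ⟨ cost cTour ⟩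
  tour-spec W D ℓ g r D≤ r≤ = run tourF (cost bTour) 0
    ( _ , _ , ⇓≤-mono (rounds (loop loadF (‵ 0)) r≤) (load-spec r)
    , (λ le →
        _ , _ , ⇓≤-mono (rounds (loop bestTourF bBestTour) (s≤s D≤)) (bestTour-spec W D r r≤)
      , _ , _ , within-spec g (bestTour W D r)
      , cong (encBest encPath) (sym (if-≤ le)) , ≤-refl , z≤n)
    -- Only `loadF` has been called; the other summands of `bTour` remain unspent.
    , (λ gt → cong (encBest encPath) (sym (if-> gt))
            , ≤-trans (m≤m+n _ _) (m≤m+n _ _) , z≤n))

  addTour-spec : ∀ (e : Best (Path n)) E →
    addTourF · encBest encPath e ∷ encBest (encList encPath) E ∷ []
      ⇓≤ encBest (encList encPath) (addTour e E) ⟨ cost cAddTour ⟩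
  addTour-spec nothing        E               = run addTourF 0 0 (refl , z≤n , z≤n)
  addTour-spec (just (w , p)) nothing         = run addTourF 0 0 (refl , z≤n , z≤n)
  addTour-spec (just (w , p)) (just (W , ps)) = run addTourF 0 0 (refl , z≤n , z≤n)

  tours-spec : ∀ W D ℓ g rs → length D ≤ n → 2 + room rs ≤ cost L →
    toursF · encMatrix W ∷ encPath D ∷ num ℓ ∷ encEntry g ∷ encRoutes rs ∷ []
      ⇓≤ encBest (encList encPath) (tours W D ℓ g rs) ⟨ suc (length rs) * cost (loop toursF bTours) ⟩
  tours-spec W D ℓ g []       D≤ rs≤ = run toursF (cost bTours) 0 (refl , z≤n , z≤n)
  tours-spec W D ℓ g (r ∷ rs) D≤ rs≤ =
    run toursF (cost bTours) (suc (length rs) * cost (loop toursF bTours))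
    ( _ , _ , tour-spec W D ℓ g r D≤
                (≤-trans (≤-trans (m≤m+n _ _) (m≤n+m _ 2)) rs≤)
    , _ , _ , tours-spec W D ℓ g rs D≤
                (≤-trans (+-monoʳ-≤ 2 (m≤n+m (room rs) (suc (length r)))) rs≤)
    , _ , _ , addTour-spec (tour W D ℓ g r) (tours W D ℓ g rs)
    , refl , ≤-refl , ≤-refl)

  length-spec : ∀ (rs : List (Route n)) →
    lengthF · encRoutes rs ∷ [] ⇓≤ num (length rs) ⟨ suc (length rs) * cost (loop lengthF (‵ 0)) ⟩
  length-spec []       = run lengthF 0 0 (refl , z≤n , z≤n)
  length-spec (r ∷ rs) = run lengthF 0 (suc (length rs) * cost (loop lengthF (‵ 0)))
    (_ , _ , length-spec rs , refl , z≤n , ≤-refl)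

  label-spec : ∀ as (E : Best (List (Path n))) →
    labelF · encList num as ∷ encBest (encList encPath) E ∷ []
      ⇓≤ encBest encSolution (label as E) ⟨ cost cLabel ⟩
  label-spec as nothing         = run labelF 0 0 (refl , z≤n , z≤n)
  label-spec as (just (W , ps)) = run labelF 0 0 (refl , z≤n , z≤n)

  evaluate-spec : ∀ W D k ℓ g p → length D ≤ n → 2 + room (proj₂ p) ≤ cost L →
    evaluateF · encMatrix W ∷ encPath D ∷ num k ∷ num ℓ ∷ encEntry g ∷ encPlan p ∷ []
      ⇓≤ encBest encSolution (evaluate W D k ℓ g p) ⟨ cost cEvaluate ⟩
  evaluate-spec W D k ℓ g (as , rs) D≤ rs≤ = run evaluateF (cost bEvaluate) 0
    ( _ , _ , ⇓≤-mono (rounds (loop lengthF (‵ 0)) suc-rs≤) (length-spec rs)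
    , (λ le →
        _ , _ , ⇓≤-mono (rounds (loop toursF bTours) suc-rs≤) (tours-spec W D ℓ g rs D≤ rs≤)
      , _ , _ , label-spec as (tours W D ℓ g rs)
      , cong (encBest encSolution) (sym (if-≤ le)) , ≤-refl , z≤n)
    , (λ gt → cong (encBest encSolution) (sym (if-> gt))
            , ≤-trans (m≤m+n _ _) (m≤m+n _ _) , z≤n))
    where suc-rs≤ = ≤-trans (≤-trans (s≤s (length≤room rs)) (n≤1+n _)) rs≤

  bestPlan-spec : ∀ W D k ℓ g {ps} → length D ≤ n → All (λ p → 2 + room (proj₂ p) ≤ cost L) ps →
    bestPlanF · encMatrix W ∷ encPath D ∷ num k ∷ num ℓ ∷ encEntry g ∷ encList encPlan ps ∷ []
      ⇓≤ encBest encSolution (bestPlan W D k ℓ g ps) ⟨ suc (length ps) * cost (loop bestPlanF bBestPlan) ⟩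
  bestPlan-spec W D k ℓ g D≤ [] = run bestPlanF (cost bBestPlan) 0 (refl , z≤n , z≤n)
  bestPlan-spec W D k ℓ g {p ∷ ps} D≤ (p≤ ∷ ps≤) =
    run bestPlanF (cost bBestPlan) (suc (length ps) * cost (loop bestPlanF bBestPlan))
    ( _ , _ , evaluate-spec W D k ℓ g p D≤ p≤
    , _ , _ , bestPlan-spec W D k ℓ g D≤ ps≤
    , _ , _ , better-spec (evaluate W D k ℓ g p) (bestPlan W D k ℓ g ps)
    , refl , ≤-refl , ≤-refl)

  map-spec : ∀ {g p} c (encX : X → Val) (encY : Y → Val) (f : X → Y) →
    (∀ x → g · encX x ∷ p ∷ [] ⇓≤ encY (f x) ⟨ cost c ⟩) →
    ∀ xs → mapF g · encList encX xs ∷ p ∷ []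
             ⇓≤ encList encY (map f xs) ⟨ suc (length xs) * cost (loop (mapF g) c) ⟩
  map-spec {g = g} c encX encY f g-spec []       = run (mapF g) (cost c) 0 (refl , z≤n , z≤n)
  map-spec {g = g} c encX encY f g-spec (x ∷ xs) =
    run (mapF g) (cost c) (suc (length xs) * cost (loop (mapF g) c))
    (_ , _ , g-spec x , _ , _ , map-spec c encX encY f g-spec xs , refl , ≤-refl , ≤-refl)

  append-spec : ∀ (enc : X → Val) xs ys →
    appendF · encList enc xs ∷ encList enc ys ∷ []
      ⇓≤ encList enc (xs ++ ys) ⟨ suc (length xs) * cost (loop appendF (‵ 0)) ⟩
  append-spec enc []       ys = run appendF 0 0 (refl , z≤n , z≤n)
  append-spec enc (x ∷ xs) ys = run appendF 0 (suc (length xs) * cost (loop appendF (‵ 0)))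
    (_ , _ , append-spec enc xs ys , refl , z≤n , ≤-refl)

  insertions-spec : ∀ x (r : Route n) → suc (length r) ≤ cost L →
    insertionsF · encClient x ∷ encRoute r ∷ []
      ⇓≤ encRoutes (insertions x r) ⟨ suc (length r) * cost (loop insertionsF bInsertions) ⟩
  insertions-spec x []      r≤ = run insertionsF (cost bInsertions) 0 (refl , z≤n , z≤n)
  insertions-spec x (y ∷ r) r≤ =
    run insertionsF (cost bInsertions) (suc (length r) * cost (loop insertionsF bInsertions))
    ( _ , _ , insertions-spec x r (<⇒≤ r≤)
    , _ , _ , ⇓≤-mono
        (rounds (loop (mapF consF) cCons)
          (subst (λ l → suc l ≤ cost L) (sym (length-insertions x r)) r≤))
        (map-spec cCons encRoute encRoute (y ∷_)
          (λ _ → run consF 0 0 (refl , z≤n , z≤n)) (insertions x r))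
    , refl , ≤-refl , ≤-refl)

  placements-spec : ∀ x (rs : List (Route n)) → 2 + room rs ≤ cost L →
    placementsF · encClient x ∷ encRoutes rs ∷ []
      ⇓≤ encList encPlacement (placements x rs) ⟨ suc (length rs) * cost (loop placementsF bPlacements) ⟩
  placements-spec x []       rs≤ = run placementsF (cost bPlacements) 0 (refl , z≤n , z≤n)
  placements-spec x (r ∷ rs) rs≤ =
    run placementsF (cost bPlacements) (suc (length rs) * cost (loop placementsF bPlacements))
    ( _ , _ , ⇓≤-mono (rounds (loop insertionsF bInsertions) (<⇒≤ r≤)) (insertions-spec x r (<⇒≤ r≤))
    , _ , _ , ⇓≤-mono
        (rounds (loop (mapF openF) cOpen)
          (subst (λ l → suc l ≤ cost L) (sym (length-insertions x r)) r≤))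
        (map-spec cOpen encRoute encPlacement (λ r′ → 0 , r′ ∷ rs)
          (λ _ → run openF 0 0 (refl , z≤n , z≤n)) (insertions x r))
    , _ , _ , placements-spec x rs rest≤
    , _ , _ , ⇓≤-mono
        (rounds (loop (mapF skipF) cSkip)
          (subst (λ l → suc l ≤ cost L) (sym (length-placements x rs)) rest≤))
        (map-spec cSkip encPlacement encPlacement (λ (i , rs′) → suc i , r ∷ rs′)
          (λ _ → run skipF 0 0 (refl , z≤n , z≤n)) (placements x rs))
    , _ , _ , ⇓≤-mono
        (rounds (loop appendF (‵ 0))
          (subst (λ l → suc l ≤ cost L)
            (sym (trans (length-map _ (insertions x r)) (length-insertions x r))) r≤))
        (append-spec encPlacement (map _ (insertions x r)) (map _ (placements x rs)))
    , refl , ≤-refl , ≤-refl)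
    where
    r≤ : 2 + length r ≤ cost L
    r≤ = ≤-trans (s≤s (≤-trans (m≤m+n _ (room rs)) (n≤1+n _))) rs≤
    rest≤ : 2 + room rs ≤ cost L
    rest≤ = ≤-trans (+-monoʳ-≤ 2 (m≤n+m (room rs) (suc (length r)))) rs≤

  addClient-spec : ∀ x (p : Plan n) → 2 + room (proj₂ p) ≤ cost L →
    addClientF · encClient x ∷ encPlan p ∷ [] ⇓≤ encList encPlan (addClient x p) ⟨ cost cAddClient ⟩
  addClient-spec x (as , rs) rs≤ = run addClientF (cost bAddClient) 0
    ( _ , _ , ⇓≤-mono
        (rounds (loop placementsF bPlacements)
          (≤-trans (s≤s (≤-trans (length≤room rs) (n≤1+n _))) rs≤))
        (placements-spec x rs rs≤)
    , _ , _ , ⇓≤-mono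
        (rounds (loop (mapF tagF) cTag)
          (subst (λ l → suc l ≤ cost L) (sym (length-placements x rs)) rs≤))
        (map-spec cTag encPlacement encPlan (λ (i , rs′) → i ∷ as , rs′)
          (λ _ → run tagF 0 0 (refl , z≤n , z≤n)) (placements x rs))
    , refl , ≤-refl , z≤n)

  expand-spec : ∀ x {ps : List (Plan n)} → All (λ p → 2 + room (proj₂ p) ≤ cost L) ps →
    expandF · encClient x ∷ encList encPlan ps ∷ []
      ⇓≤ encList encPlan (concatMap (addClient x) ps) ⟨ suc (length ps) * cost (loop expandF bExpand) ⟩
  expand-spec x [] = run expandF (cost bExpand) 0 (refl , z≤n , z≤n)
  expand-spec x {p ∷ ps} (p≤ ∷ ps≤) =
    run expandF (cost bExpand) (suc (length ps) * cost (loop expandF bExpand))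
    ( _ , _ , addClient-spec x p p≤
    , _ , _ , expand-spec x ps≤
    , _ , _ , ⇓≤-mono
        (rounds (loop appendF (‵ 0)) (subst (λ l → suc l ≤ cost L) (sym (length-addClient x p)) p≤))
        (append-spec encPlan (addClient x p) (concatMap (addClient x) ps))
    , refl , ≤-refl , ≤-refl)

  module _ {c} (c≤n : c ≤ n) (plans≤M : (1 + 2 * c) ^ c ≤ M) where

    plans-small : ∀ (xs : Route n) → length xs ≤ c → length (plans xs) ≤ M
    plans-small xs xs≤c = ≤-trans (length-plans c xs xs≤c)
      (≤-trans (^-monoʳ-≤ (1 + 2 * c) xs≤c) plans≤M)

    plans-room-small : ∀ (xs : Route n) → length xs ≤ c →
                       All (λ p → 2 + room (proj₂ p) ≤ cost L) (plans xs)
    plans-room-small xs xs≤c = All.map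
      (λ {p} le → +-monoʳ-≤ 2 (≤-trans le (≤-trans (*-monoʳ-≤ 2 (≤-trans xs≤c c≤n))
         (≤-reflexive (cong (n +_) (+-identityʳ n))))))
      (plans-room xs)

    plans-spec : ∀ (xs : Route n) → length xs ≤ c →
      plansF · encRoute xs ∷ [] ⇓≤ encList encPlan (plans xs) ⟨ suc (length xs) * cost (loop plansF bPlans) ⟩
    plans-spec []       xs≤ = run plansF (cost bPlans) 0 (refl , z≤n , z≤n)
    plans-spec (x ∷ xs) xs≤ = run plansF (cost bPlans) (suc (length xs) * cost (loop plansF bPlans))
      ( _ , _ , plans-spec xs (<⇒≤ xs≤)
      , _ , _ , ⇓≤-mono (rounds (loop expandF bExpand) (s≤s (plans-small xs (<⇒≤ xs≤))))
                        (expand-spec x (plans-room-small xs (<⇒≤ xs≤)))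
      , refl , ≤-refl , ≤-refl)

    optimum-spec : ∀ W D (xs : Route n) k ℓ g → length D ≤ n → length xs ≤ c →
      optimumF · encMatrix W ∷ encPath D ∷ encRoute xs ∷ num k ∷ num ℓ ∷ encEntry g ∷ []
        ⇓≤ encBest encSolution (optimum W D xs k ℓ g) ⟨ cost cOptimum ⟩
    optimum-spec W D xs k ℓ g D≤ xs≤ = run optimumF (cost bOptimum) 0
      ( _ , _ , ⇓≤-mono (rounds (loop plansF bPlans) (s≤s (≤-trans xs≤ c≤n))) (plans-spec xs xs≤)
      , _ , _ , ⇓≤-mono (rounds (loop bestPlanF bBestPlan) (s≤s (plans-small xs xs≤)))
                        (bestPlan-spec W D k ℓ g D≤ (plans-room-small xs xs≤))
      , refl , ≤-refl , z≤n)

-- Optimal tours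

-- Correctness of a search has two halves: `Holds` says that a result, if any, is genuine; `≼` that
-- there is a result and that it is no heavier than a given competitor.
Holds : (ℕ → X → Set) → Best X → Set
Holds P nothing        = ⊤
Holds P (just (w , x)) = P w x

infix 4 _≼_

data _≼_ {X : Set} : Best X → ℕ → Set where
  attains : ∀ {w w′} {x : X} → w′ ≤ w → just (w′ , x) ≼ w

≼-trans : ∀ {e : Best X} {w w′} → e ≼ w → w ≤ w′ → e ≼ w′
≼-trans (attains p) q = attains (≤-trans p q)

Holds-map : ∀ {Q : ℕ → X → Set} e → (∀ {w x} → P w x → Q w x) → Holds P e → Holds Q e
Holds-map nothing  f _ = tt
Holds-map (just _) f p = f p

better-holds : ∀ e e′ → Holds P e → Holds P e′ → Holds P (better e e′)
better-holds nothing        e′      p q = q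
better-holds (just _)       nothing p q = p
better-holds (just (w , _)) (just (w′ , _)) p q with w ≤ᵇ w′
... | true  = p
... | false = q

better-≼ˡ : ∀ {e : Best X} e′ → e ≼ w → better e e′ ≼ w
better-≼ˡ nothing (attains p) = attains p
better-≼ˡ (just (v , _)) (attains {w′ = w′} p) with w′ ≤ᵇ v in eq
... | true  = attains p
... | false = attains (≤-trans (≰⇒≥ λ le → subst T eq (≤⇒≤ᵇ le)) p)

better-≼ʳ : ∀ (e : Best X) {e′} → e′ ≼ w → better e e′ ≼ w
better-≼ʳ nothing p = p
better-≼ʳ (just (v , _)) (attains {w′ = w′} p) with v ≤ᵇ w′ in eq
... | true  = attains (≤-trans (≤ᵇ⇒≤ v w′ (subst T (sym eq) tt)) p)
... | false = attains p

within-holds : ∀ {P : ℕ → X → Set} g e → Holds P e → Holds (λ w x → P w x × Maybe.All (w ≤_) g) (within g e)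
within-holds nothing  e h = Holds-map e (λ p → p , Maybe.nothing) h
within-holds (just g) nothing h = tt
within-holds (just g) (just (w , x)) h with w ≤ᵇ g in eq
... | true  = h , Maybe.just (≤ᵇ⇒≤ w g (subst T (sym eq) tt))
... | false = tt

within-≼ : ∀ {w g} {e : Best X} → Maybe.All (w ≤_) g → e ≼ w → within g e ≼ w
within-≼ Maybe.nothing p = p
within-≼ (Maybe.just w≤g) (attains p) = subst (_≼ _) (sym (if-≤ (≤-trans p w≤g))) (attains p)

place-nothing : ∀ {m} (Q : Fin m → ℕ → X → Set) j → Holds (Q j) (place zero nothing j)
place-nothing Q zero    = tt
place-nothing Q (suc j) = place-nothing (Q ∘ suc) j

place-holds : ∀ {m} (Q : Fin m → ℕ → X → Set) s {e} → Holds (Q s) e →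
              ∀ j → Holds (Q j) (place (toℕ s) e j)
place-holds Q zero    h zero    = h
place-holds Q zero    h (suc j) = place-nothing (Q ∘ suc) j
place-holds Q (suc s) h zero    = tt
place-holds Q (suc s) h (suc j) = place-holds (Q ∘ suc) s h j

place-≼ : ∀ {m} (s : Fin m) {e : Best X} → e ≼ w → place (toℕ s) e s ≼ w
place-≼ zero    p = p
place-≼ (suc s) p = place-≼ s p

-- Pigeonhole: without repetitions, the map from positions to vertices is injective.
unique-length : ∀ {p : Path n} → Unique p → length p ≤ n
unique-length !p = injective⇒≤ (injective !p)
  where
  injective : ∀ {p : Path n} → Unique p → ∀ {i j} → lookup p i ≡ lookup p j → i ≡ j
  injective (_ ∷ _)   {zero}  {zero}  _  = refl
  injective (x∉p ∷ _) {zero}  {suc j} eq = contradiction eq (All.lookup x∉p (∈-lookup j))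
  injective (x∉p ∷ _) {suc i} {zero}  eq = contradiction (sym eq) (All.lookup x∉p (∈-lookup i))
  injective (_ ∷ !p)  {suc i} {suc j} eq = cong suc (injective !p eq)

-- Walks visiting given stops in order

data InOrder {n} : Route n → Path n → Set where
  []   : ∀ {p} → InOrder [] p
  skip : ∀ {r v p} → InOrder r p → InOrder r (v ∷ p)
  -- A vertex may serve several consecutive stops.
  take : ∀ {r c δ p} → InOrder r (c ∷ p) → InOrder ((c , δ) ∷ r) (c ∷ p)

module _ {n} (W : Matrix n) where
  open DecMembership (_≟_ {n}) using (_∈?_)

  data IsWalk : Fin n → Fin n → ℕ → Path n → Set where
    [_] : ∀ d → IsWalk d d 0 (d ∷ [])
    _∷_ : ∀ {u v d ω w p} → W u v ≡ just ω → IsWalk v d w p → IsWalk u d (ω + w) (u ∷ p)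

  suffix : ∀ {u v d w p} → IsWalk v d w p → Unique p → u ∈ p →
           ∃[ w′ ] ∃[ p′ ] w′ ≤ w × IsWalk u d w′ p′ × Unique p′
  suffix [ d ]   !p (here refl) = _ , _ , ≤-refl , [ d ] , !p
  suffix (e ∷ q) !p (here refl) = _ , _ , ≤-refl , e ∷ q , !p
  suffix (_∷_ {ω = ω} e q) (_ ∷ !p) (there u∈p) =
    let _ , _ , le , q′ , !p′ = suffix q !p u∈p
    in _ , _ , ≤-trans le (m≤n+m _ ω) , q′ , !p′

  -- If u recurs on the already simplified rest, everything before that occurrence is cut off.
  -- Weights being natural numbers, dropping edges never makes the walk heavier.
  simplify : ∀ {v d w p} → IsWalk v d w p →
             ∃[ w′ ] ∃[ p′ ] w′ ≤ w × IsWalk v d w′ p′ × Unique p′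
  simplify [ d ] = _ , _ , ≤-refl , [ d ] , [] ∷ []
  simplify (_∷_ {u = u} {ω = ω} e q) with simplify q
  ... | _ , p′ , le , q′ , !p′ with u ∈? p′
  ... | yes u∈p′ =
    let _ , _ , le′ , q″ , !p″ = suffix q′ !p′ u∈p′
    in _ , _ , ≤-trans le′ (≤-trans le (m≤n+m _ ω)) , q″ , !p″
  ... | no  u∉p′ =
    _ , _ , +-monoʳ-≤ ω le , e ∷ q′ ,
    All.tabulate (λ x∈p′ u≡x → u∉p′ (subst (_∈ p′) (sym u≡x) x∈p′)) ∷ !p′

  prepend-≼ : ∀ {u ω m} {e : Best (Path n)} → m ≡ just ω → e ≼ w → prepend u m e ≼ ω + w
  prepend-≼ {ω = ω} refl (attains p) = attains (+-monoʳ-≤ ω p)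

  bestStep-≼ : ∀ {u ω m} (r : Fin m → Maybe ℕ) (σ : Fin m → Best (Path n)) v →
               r v ≡ just ω → σ v ≼ w → bestStep u r σ ≼ ω + w
  bestStep-≼ r σ zero    e p = better-≼ˡ (bestStep _ (r ∘ suc) (σ ∘ suc)) (prepend-≼ e p)
  bestStep-≼ r σ (suc v) e p = better-≼ʳ (prepend _ (r zero) (σ zero)) (bestStep-≼ (r ∘ suc) (σ ∘ suc) v e p)

  relaxTimes-≼-stay : ∀ k (σ : Fin n → Best (Path n)) v → σ v ≼ w → relaxTimes k W σ v ≼ w
  relaxTimes-≼-stay zero    σ v p = p
  relaxTimes-≼-stay (suc k) σ v p =
    better-≼ˡ (bestStep v (W v) (relaxTimes k W σ)) (relaxTimes-≼-stay k σ v p)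

  -- The Bellman-Ford invariant: k rounds take into account every walk of at most k edges, that is,
  -- suc k vertices. The first edge of the walk is handled by the last round.
  relaxTimes-≼ : ∀ k (σ : Fin n → Best (Path n)) {t s ω q} → IsWalk t s ω q → length q ≤ suc k →
                 σ s ≼ w → relaxTimes k W σ t ≼ ω + w
  relaxTimes-≼ k σ [ d ] _ p = relaxTimes-≼-stay k σ d p
  relaxTimes-≼ zero    σ (_ ∷ [ _ ])   (s≤s ())
  relaxTimes-≼ zero    σ (_ ∷ (_ ∷ _)) (s≤s ())
  relaxTimes-≼ {w = w} (suc k) σ {t} (_∷_ {v = v} {ω = ω} {w = ω′} e q) (s≤s le) p =
    better-≼ʳ (relaxTimes k W σ t)
      (subst (bestStep t (W t) (relaxTimes k W σ) ≼_) (sym (+-assoc ω ω′ w))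
        (bestStep-≼ (W t) (relaxTimes k W σ) v e (relaxTimes-≼ k σ q le p)))

  -- Soundness for any property of labels that survives prepending an edge; it is applied to walks
  -- to a depot that pass the remaining stops in order.
  module _ (P : Fin n → ℕ → Path n → Set)
    (step : ∀ {u v ω w p} → W u v ≡ just ω → P v w p → P u (ω + w) (u ∷ p)) where

    bestStep-holds : ∀ {m} u (r : Fin m → Maybe ℕ) (σ : Fin m → Best (Path n)) (name : Fin m → Fin n) →
                     (∀ v → r v ≡ W u (name v)) → (∀ v → Holds (P (name v)) (σ v)) →
                     Holds (P u) (bestStep u r σ)
    bestStep-holds {zero}  u r σ name r≡ h = tt
    bestStep-holds {suc m} u r σ name r≡ h =
      better-holds (prepend u (r zero) (σ zero)) _ (prepend-holds (r zero) (σ zero) (r≡ zero) (h zero))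
        (bestStep-holds u (r ∘ suc) (σ ∘ suc) (name ∘ suc) (r≡ ∘ suc) (h ∘ suc))
      where
      prepend-holds : ∀ {v} m e → m ≡ W u v → Holds (P v) e → Holds (P u) (prepend u m e)
      prepend-holds nothing  e        _  _ = tt
      prepend-holds (just ω) nothing  _  _ = tt
      prepend-holds (just ω) (just _) eq p = step (sym eq) p

    relaxTimes-holds : ∀ k {σ} → (∀ v → Holds (P v) (σ v)) → ∀ v → Holds (P v) (relaxTimes k W σ v)
    relaxTimes-holds zero        h v = h v
    relaxTimes-holds (suc k) {σ} h v =
      better-holds (relaxTimes k W σ v) (bestStep v (W v) (relaxTimes k W σ)) (relaxTimes-holds k h v)
        (bestStep-holds v (W v) _ (λ u → u) (λ _ → refl) (relaxTimes-holds k h))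

    hop-holds : ∀ s t {e} → Holds (P s) e → Holds (P t) (hop W s t e)
    hop-holds s t h = relaxTimes-holds n (place-holds P s h) t

  hop-≼ : ∀ {s t ω q e} → IsWalk t s ω q → e ≼ w → hop W s t e ≼ ω + w
  hop-≼ {w = w} {s} {t} {ω} {e = e} q p =
    let _ , _ , le , q′ , !q′ = simplify q
    -- A simple walk has at most n vertices, and n rounds cover up to suc n.
    in ≼-trans (relaxTimes-≼ n (place (toℕ s) e) q′ (≤-trans (unique-length !q′) (n≤1+n n)) (place-≼ s p))
               (+-monoˡ-≤ w le)

  -- The cut is where the first stop is taken. Since `take` leaves c on the list, the second part
  -- starts at c and still passes all remaining stops.
  splitWalk : ∀ {c δ r t d w p} → IsWalk t d w p → InOrder ((c , δ) ∷ r) p →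
              ∃[ w₁ ] ∃[ w₂ ] ∃[ p₁ ] ∃[ p₂ ]
                IsWalk t c w₁ p₁ × IsWalk c d w₂ p₂ × InOrder r p₂ × w ≡ w₁ + w₂
  splitWalk [ d ]   (take o) = _ , _ , _ , _ , [ d ] , [ d ] , o , refl
  splitWalk (e ∷ q) (take o) = _ , _ , _ , _ , [ _ ] , e ∷ q , o , refl
  splitWalk (_∷_ {ω = ω} e q) (skip o) =
    let w₁ , w₂ , _ , _ , q₁ , q₂ , o′ , eq = splitWalk q o
    in _ , _ , _ , _ , e ∷ q₁ , q₂ , o′ , trans (cong (ω +_) eq) (sym (+-assoc ω w₁ w₂))
  splitWalk [ d ] (skip ())

  reach-≼ : ∀ {d t w p} r → IsWalk t d w p → InOrder r p → reach W d t r ≼ w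
  reach-≼ {d} {t} []      q _ = subst (hop W d t _ ≼_) (+-identityʳ _) (hop-≼ q (attains ≤-refl))
  reach-≼ {d} {t} ((c , δ) ∷ r) q o =
    let _ , _ , _ , _ , q₁ , q₂ , o′ , eq = splitWalk q o
    in subst (hop W c t _ ≼_) (sym eq) (hop-≼ q₁ (reach-≼ r q₂ o′))

  reach-holds : ∀ d t r → Holds (λ w p → IsWalk t d w p × InOrder r p) (reach W d t r)
  reach-holds d t []      = hop-holds (λ u w p → IsWalk u d w p × InOrder [] p)
    (λ e (q , _) → e ∷ q , []) d t ([ d ] , [])
  reach-holds d t ((c , δ) ∷ r) = hop-holds (λ u w p → IsWalk u d w p × InOrder ((c , δ) ∷ r) p)
    (λ e (q , o) → e ∷ q , skip o) c t
    -- Both shapes of a walk from c have c at the head of the list, which `take` needs to see.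
    (Holds-map (reach W d c r) (λ { ([ _ ] , o) → [ _ ] , take o ; (e ∷ q , o) → e ∷ q , take o }) (reach-holds d c r))

  module _ (D : List (Fin n)) where

    ClosedTour : Route n → ℕ → Path n → Set
    ClosedTour r w p = ∃[ d ] d ∈ D × IsWalk d d w p × InOrder r p

    bestTour-holds : ∀ r → Holds (ClosedTour r) (bestTour W D r)
    bestTour-holds r = go D (λ d∈D → d∈D)
      where
      go : ∀ ds → (∀ {d} → d ∈ ds → d ∈ D) → Holds (ClosedTour r) (bestTour W ds r)
      go []       _  = tt
      go (d ∷ ds) ⊆D = better-holds (reach W d d r) _
        (Holds-map (reach W d d r) (λ (q , o) → d , ⊆D (here refl) , q , o) (reach-holds d d r))
        (go ds (⊆D ∘ there))

  bestTour-≼ : ∀ {D w p} r → ClosedTour D r w p → bestTour W D r ≼ w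
  bestTour-≼ {_ ∷ ds} r (d , here refl , q , o) = better-≼ˡ (bestTour W ds r) (reach-≼ r q o)
  bestTour-≼ {d ∷ ds} r (_ , there d∈ , q , o)  =
    better-≼ʳ (reach W d d r) (bestTour-≼ r (_ , d∈ , q , o))

  module _ (D : List (Fin n)) (ℓ : ℕ) (g : Maybe ℕ) where

    FeasibleTour : Route n → ℕ → Path n → Set
    FeasibleTour r w p = ClosedTour D r w p × load r ≤ ℓ × Maybe.All (w ≤_) g

    data Tours : List (Route n) → ℕ → List (Path n) → Set where
      []  : Tours [] 0 []
      _∷_ : ∀ {r w p rs w′ ps} → FeasibleTour r w p → Tours rs w′ ps → Tours (r ∷ rs) (w + w′) (p ∷ ps)

    tour-holds : ∀ r → Holds (FeasibleTour r) (tour W D ℓ g r)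
    tour-holds r with load r ≤ᵇ ℓ in eq
    ... | true  = Holds-map (within g (bestTour W D r))
                    (λ (t , fuel) → t , ≤ᵇ⇒≤ (load r) ℓ (subst T (sym eq) tt) , fuel)
                    (within-holds g (bestTour W D r) (bestTour-holds D r))
    ... | false = tt

    tour-≼ : ∀ {r w p} → FeasibleTour r w p → tour W D ℓ g r ≼ w
    tour-≼ {r} (t , l≤ , fuel) = subst (_≼ _) (sym (if-≤ l≤)) (within-≼ fuel (bestTour-≼ r t))

    tours-holds : ∀ rs → Holds (Tours rs) (tours W D ℓ g rs)
    tours-holds []       = []
    tours-holds (r ∷ rs) with tour W D ℓ g r | tour-holds r | tours W D ℓ g rs | tours-holds rs
    ... | nothing | _ | _       | _  = tt
    ... | just _  | t | nothing | _  = tt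
    ... | just _  | t | just _  | ts = t ∷ ts

    tours-≼ : ∀ {rs ws} → Pointwise (λ r w → ∃[ p ] FeasibleTour r w p) rs ws → tours W D ℓ g rs ≼ sum ws
    tours-≼ []             = attains z≤n
    tours-≼ {r ∷ rs} ((_ , t) ∷ ts) with tour W D ℓ g r | tour-≼ t | tours W D ℓ g rs | tours-≼ ts
    ... | _ | attains p | _ | attains q = attains (+-mono-≤ p q)

    module _ (k : ℕ) where

      Realises : Plan n → ℕ → Solution n → Set
      Realises (as , rs) w (ps , as′) = as ≡ as′ × length rs ≤ k × Tours rs w ps

      evaluate-holds : ∀ p → Holds (Realises p) (evaluate W D k ℓ g p)
      evaluate-holds (as , rs) with length rs ≤ᵇ k in eq
      ... | false = tt
      ... | true with tours W D ℓ g rs | tours-holds rs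
      ...   | nothing | _  = tt
      ...   | just _  | ts = refl , ≤ᵇ⇒≤ (length rs) k (subst T (sym eq) tt) , ts

      evaluate-≼ : ∀ {as rs ws} → length rs ≤ k →
                   Pointwise (λ r w → ∃[ p ] FeasibleTour r w p) rs ws →
                   evaluate W D k ℓ g (as , rs) ≼ sum ws
      evaluate-≼ {rs = rs} rs≤k ts = subst (_≼ _) (sym (if-≤ rs≤k)) (label-≼ (tours-≼ ts))
        where
        label-≼ : ∀ {as e w} → e ≼ w → label {n} as e ≼ w
        label-≼ (attains p) = attains p

      bestPlan-holds : ∀ ps → Holds (λ w s → Any (λ p → Realises p w s) ps) (bestPlan W D k ℓ g ps)
      bestPlan-holds []       = tt
      bestPlan-holds (p ∷ ps) = better-holds (evaluate W D k ℓ g p) _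
        (Holds-map (evaluate W D k ℓ g p) here (evaluate-holds p))
        (Holds-map (bestPlan W D k ℓ g ps) there (bestPlan-holds ps))

      bestPlan-≼ : ∀ {p ps} → p ∈ ps → evaluate W D k ℓ g p ≼ w → bestPlan W D k ℓ g ps ≼ w
      bestPlan-≼ {ps = _ ∷ ps} (here refl) p≼ = better-≼ˡ (bestPlan W D k ℓ g ps) p≼
      bestPlan-≼ {ps = p ∷ _}  (there p∈)  p≼ = better-≼ʳ (evaluate W D k ℓ g p) (bestPlan-≼ p∈ p≼)

-- Plans and assignments

-- [] when the number is out of range
route : List (List X) → ℕ → List X
route []       i       = []
route (r ∷ rs) zero    = r
route (r ∷ rs) (suc i) = route rs i

route-lookup : ∀ (rs : List (List X)) i → route rs (toℕ i) ≡ lookup rs i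
route-lookup (r ∷ rs) zero    = refl
route-lookup (r ∷ rs) (suc i) = route-lookup rs i

assignedLoad : Route n → List ℕ → ℕ → ℕ
assignedLoad items as i = sum (zipWith (λ (_ , δ) a → if a ≡ᵇ i then δ else 0) items as)

insertions-load : ∀ (x : Fin n × ℕ) r →
  All (λ r′ → load r′ ≡ proj₂ x + load r × x ∈ r′ × (∀ {y} → y ∈ r → y ∈ r′)) (insertions x r)
insertions-load x []              = (refl , here refl , λ ()) ∷ []
insertions-load x@(_ , δ) ((c , ε) ∷ r) = (refl , here refl , there) ∷ All.map⁺ (All.map
  (λ (eq , x∈ , ⊆) →
      trans (cong (ε +_) eq) (solve 3 (λ e d l → e :+ (d :+ l) := d :+ (e :+ l)) refl ε δ (load r))
    , there x∈
    , λ { (here refl) → here refl ; (there y∈) → there (⊆ y∈) })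
  (insertions-load x r))

-- As `route` is total, the equation for the loads makes sense also at the number of a newly opened
-- route, which was empty before.
record Placed (x : Fin n × ℕ) (rs : List (Route n)) (j : ℕ) (rs′ : List (Route n)) : Set where
  field
    loads   : ∀ i → load (route rs′ i) ≡ (if j ≡ᵇ i then proj₂ x else 0) + load (route rs i)
    keeps   : ∀ i {y} → y ∈ route rs i → y ∈ route rs′ i
    gets    : x ∈ route rs′ j
    inRange : j < length rs′
    grows   : length rs ≤ length rs′

open Placed

placements-placed : ∀ (x : Fin n × ℕ) rs → All (λ (j , rs′) → Placed x rs j rs′) (placements x rs)
placements-placed x [] = record
  { loads = λ { zero → refl ; (suc i) → refl } ; keeps = λ { _ () }
  ; gets = here refl ; inRange = s≤s z≤n ; grows = z≤n } ∷ []
placements-placed x (r ∷ rs) = All.++⁺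
  (All.map⁺ (All.map (λ (eq , x∈ , ⊆) → record
      { loads = λ { zero → eq ; (suc i) → refl }
      ; keeps = λ { zero y∈ → ⊆ y∈ ; (suc i) y∈ → y∈ }
      ; gets = x∈ ; inRange = s≤s z≤n ; grows = ≤-refl })
    (insertions-load x r)))
  (All.map⁺ (All.map (λ p → record
      { loads = λ { zero → refl ; (suc i) → loads p i }
      ; keeps = λ { zero y∈ → y∈ ; (suc i) y∈ → keeps p i y∈ }
      ; gets = gets p ; inRange = s≤s (inRange p) ; grows = s≤s (grows p) })
    (placements-placed x rs)))

Serves : List (Route n) → Fin n × ℕ → ℕ → Set
Serves rs x a = a < length rs × x ∈ route rs a

-- The invariant survives an insertion: the demand of x enters both sides at the same number, and
-- since routes only gain stops, earlier clients are still served under their old numbers.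
plans-sound : ∀ (items : Route n) → All (λ (as , rs) →
  (∀ i → assignedLoad items as i ≡ load (route rs i)) × Pointwise (Serves rs) items as) (plans items)
plans-sound []            = ((λ i → refl) , []) ∷ []
plans-sound (x ∷ items) = All.concat⁺ (All.map⁺ (All.map
  (λ {(as , rs)} (eq , serves) → All.map⁺ (All.map
    (λ {(j , rs′)} p →
        (λ i → trans (cong ((if j ≡ᵇ i then proj₂ x else 0) +_) (eq i)) (sym (loads p i)))
      , (inRange p , gets p)
      ∷ Pointwise.map (λ {_} {a} (a< , y∈) → ≤-trans a< (grows p) , keeps p a y∈) serves)
    (placements-placed x rs)))
  (plans-sound items)))

-- The given occurrence of c on p determines the position: stops taken before the walk gets there
-- precede c, the others follow it.
insertions-inOrder : ∀ {c δ p} {r : Route n} → c ∈ p → InOrder r p →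
                     ∃[ r′ ] r′ ∈ insertions (c , δ) r × InOrder r′ p
insertions-inOrder {r = []}    (here refl) o = _ , here refl , take o
insertions-inOrder {r = _ ∷ _} (here refl) o = _ , here refl , take o
insertions-inOrder (there c∈p) [] with insertions-inOrder c∈p []
... | _ , r′∈ , o′ = _ , r′∈ , skip o′
insertions-inOrder (there c∈p) (skip o) with insertions-inOrder c∈p o
... | _ , r′∈ , o′ = _ , r′∈ , skip o′
insertions-inOrder c∈p@(there _) (take o) with insertions-inOrder c∈p o
... | _ , r′∈ , o′ = _ , there (∈-map⁺ _ r′∈) , take o′

module _ {k′} (π : Fin k′ → Path n) where

  Assigned : ℕ → Set
  Assigned n = List ((Fin n × ℕ) × Fin k′)

  vehicleLoad : Assigned n → Fin k′ → ℕ
  vehicleLoad zs j = sum (map (λ ((_ , δ) , j′) → if does (j′ ≟ j) then δ else 0) zs)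

  -- Only an upper bound on the load is ever used. With an inequality, an unchanged route still fits
  -- after a new client is assigned, whichever vehicle serves it.
  Fits : Assigned n → Route n → Fin k′ → Set
  Fits zs r j = InOrder r (π j) × load r ≤ vehicleLoad zs j

  Fits-∷ : ∀ z zs {r} j → Fits zs r j → Fits (z ∷ zs) r j
  Fits-∷ z zs j (o , l≤) = o , ≤-trans l≤ (m≤n+m _ _)

  -- The vehicles us follow the routes rs; the vehicles vs are idle.
  placements-complete : ∀ {c δ j zs rs us vs} → c ∈ π j → j ∈ us ++ vs → Pointwise (Fits zs) rs us →
    ∃[ i ] ∃[ rs′ ] (i , rs′) ∈ placements (c , δ) rs ×
      (∃[ us′ ] ∃[ vs′ ] us′ ++ vs′ ↭ us ++ vs × Pointwise (Fits (((c , δ) , j) ∷ zs)) rs′ us′)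
  -- Behind the last route: j is among the idle vehicles, so the client opens a new route and j
  -- becomes the vehicle following it.
  placements-complete {c} {δ} {j} {zs} c∈ j∈ [] with ∈-∃++ j∈
  ... | xs , ys , refl = _ , _ , here refl , j ∷ [] , xs ++ ys , ↭-sym (shift j xs ys) ,
    (single c∈ , δ≤) ∷ []
    where
    single : ∀ {p} → c ∈ p → InOrder ((c , δ) ∷ []) p
    single (here refl) = take []
    single (there c∈)  = skip (single c∈)
    δ≤ : δ + 0 ≤ vehicleLoad (((c , δ) , j) ∷ zs) j
    δ≤ rewrite dec-true (j ≟ j) refl = +-monoʳ-≤ δ z≤n
  placements-complete {c} {δ} {zs = zs} {rs = r ∷ rs} {us = u ∷ us} c∈ (here refl) ((o , l≤) ∷ fits)
    with insertions-inOrder {δ = δ} c∈ o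
  ... | r′ , r′∈ , o′ = _ , _ , ∈-++⁺ˡ (∈-map⁺ _ r′∈) , _ , _ , ↭-refl ,
    (o′ , δ+l≤) ∷ Pointwise.map (λ {_} {j} → Fits-∷ ((c , δ) , u) zs j) fits
    where
    δ+l≤ : load r′ ≤ vehicleLoad (((c , δ) , u) ∷ zs) u
    δ+l≤ rewrite dec-true (u ≟ u) refl | proj₁ (All.lookup (insertions-load (c , δ) r) r′∈) =
      +-monoʳ-≤ δ l≤
  placements-complete {c} {δ} {j} {zs} {r ∷ rs} {u ∷ us} c∈ (there j∈) (fit ∷ fits)
    with placements-complete {δ = δ} {zs = zs} c∈ j∈ fits
  ... | i , rs′ , rs′∈ , us′ , vs′ , perm , fits′ =
    _ , _ , ∈-++⁺ʳ (map _ (insertions (c , δ) r)) (∈-map⁺ _ rs′∈) , u ∷ us′ , vs′ , prep u perm ,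
    Fits-∷ ((c , δ) , j) zs u fit ∷ fits′

  -- Every assignment of clients to walks is imitated by some plan: all vehicles start idle, and
  -- each client is inserted where its own vehicle passes it. The permutation records the order in
  -- which vehicles received their routes.
  plans-complete : ∀ zs → All (λ ((c , _) , j) → c ∈ π j) zs →
    ∃[ as ] ∃[ rs ] (as , rs) ∈ plans (map proj₁ zs) ×
      (∃[ us ] ∃[ vs ] us ++ vs ↭ allFin k′ × Pointwise (Fits zs) rs us)
  plans-complete []                   []           =
    _ , _ , here refl , [] , allFin k′ , ↭-refl , []
  plans-complete (((c , δ) , j) ∷ zs) (c∈ ∷ cs∈) with plans-complete zs cs∈
  ... | as , rs , p∈ , us , vs , perm , fits
    with placements-complete {δ = δ} {zs = zs} c∈ (∈-resp-↭ (↭-sym perm) (∈-allFin j)) fits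
  ... | i , rs′ , rs′∈ , us′ , vs′ , perm′ , fits′ =
    _ , _ , ∈-concatMap⁺ (addClient (c , δ)) (lose p∈ (∈-map⁺ _ rs′∈)) ,
    us′ , vs′ , ↭-trans perm′ perm , fits′

-- Routings

map-tabulateOn : ∀ (h : X → Y) (S : Subset n) (f : ∀ v → v ∈ˢ S → X) →
                 map h (tabulateOn S f) ≡ tabulateOn S (λ v v∈S → h (f v v∈S))
map-tabulateOn h []            f = refl
map-tabulateOn h (inside  ∷ S) f = cong (_ ∷_) (map-tabulateOn h S _)
map-tabulateOn h (outside ∷ S) f = map-tabulateOn h S _

tabulateOn-cong : ∀ (S : Subset n) {f g : ∀ v → v ∈ˢ S → X} →
                  (∀ v v∈S → f v v∈S ≡ g v v∈S) → tabulateOn S f ≡ tabulateOn S g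
tabulateOn-cong []            eq = refl
tabulateOn-cong (inside  ∷ S) eq =
  cong₂ _∷_ (eq zero here) (tabulateOn-cong S λ v v∈S → eq (suc v) (there v∈S))
tabulateOn-cong (outside ∷ S) eq = tabulateOn-cong S λ v v∈S → eq (suc v) (there v∈S)

zipWith-tabulateOn : ∀ (h : X → Y → Z) (S : Subset n) (f : ∀ v → v ∈ˢ S → X) (g : ∀ v → v ∈ˢ S → Y) →
  zipWith h (tabulateOn S f) (tabulateOn S g) ≡ tabulateOn S (λ v v∈S → h (f v v∈S) (g v v∈S))
zipWith-tabulateOn h []            f g = refl
zipWith-tabulateOn h (inside  ∷ S) f g = cong (_ ∷_) (zipWith-tabulateOn h S _ _)
zipWith-tabulateOn h (outside ∷ S) f g = zipWith-tabulateOn h S _ _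

length-tabulateOn : ∀ (S : Subset n) (f : ∀ v → v ∈ˢ S → X) → length (tabulateOn S f) ≡ ∣ S ∣
length-tabulateOn []            f = refl
length-tabulateOn (inside  ∷ S) f = cong suc (length-tabulateOn S _)
length-tabulateOn (outside ∷ S) f = length-tabulateOn S _

tabulateOn⁺ : ∀ {P : X → Set} (S : Subset n) {f : ∀ v → v ∈ˢ S → X} →
              (∀ v v∈S → P (f v v∈S)) → All P (tabulateOn S f)
tabulateOn⁺ []            p = []
tabulateOn⁺ (inside  ∷ S) p = p zero here ∷ tabulateOn⁺ S λ v v∈S → p (suc v) (there v∈S)
tabulateOn⁺ (outside ∷ S) p = tabulateOn⁺ S λ v v∈S → p (suc v) (there v∈S)

∈-tabulateOn : ∀ {S : Subset n} (f : ∀ v → v ∈ˢ S → X) {v} (v∈S : v ∈ˢ S) → f v v∈S ∈ tabulateOn S f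
∈-tabulateOn {S = inside  ∷ S} f here        = here refl
∈-tabulateOn {S = inside  ∷ S} f (there v∈S) = there (∈-tabulateOn _ v∈S)
∈-tabulateOn {S = outside ∷ S} f (there v∈S) = ∈-tabulateOn _ v∈S

-- The search yields the route numbers as a list, whereas a `Routing` wants a function on the
-- clients.
untabulateOn : ∀ {R : X → Y → Set} (S : Subset n) {f : ∀ v → v ∈ˢ S → X} {ys} →
  Pointwise R (tabulateOn S f) ys →
  ∃[ g ] tabulateOn S g ≡ ys × (∀ v v∈S → R (f v v∈S) (g v v∈S))
untabulateOn []            []       = (λ _ ()) , refl , λ _ ()
untabulateOn (inside ∷ S) {f} {y ∷ _} (r ∷ rs) with untabulateOn S rs
... | g , eq , h =
  (λ { zero here → y ; (suc v) (there v∈S) → g v v∈S }) ,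
  cong (y ∷_) eq ,
  λ { zero here → r ; (suc v) (there v∈S) → h v v∈S }
untabulateOn (outside ∷ S) rs with untabulateOn S rs
... | g , eq , h =
  (λ { (suc v) (there v∈S) → g v v∈S }) , eq , λ { (suc v) (there v∈S) → h v v∈S }

last-∷ : ∀ (x y : X) ys → List⁺.last (x ∷ y ∷ ys) ≡ List⁺.last (y ∷ ys)
last-∷ x y ys with initLast ys
... | []       = refl
... | zs ∷ʳ′ z = refl

does-toℕ-≟ : ∀ (i j : Fin m) → does (i ≟ j) ≡ (toℕ i ≡ᵇ toℕ j)
does-toℕ-≟ zero    zero    = refl
does-toℕ-≟ zero    (suc j) = refl
does-toℕ-≟ (suc i) zero    = refl
does-toℕ-≟ (suc i) (suc j) = does-toℕ-≟ i j

-- Demands may vanish and the gas limit may be absent, so one proof serves all three problems: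
-- GasCVRP is the case of zero demands and load capacity 0.
module Correctness (I : Common) (demand : ∀ c → c ∈ˢ Common.clients I → ℕ)
                   (ℓ : ℕ) (g : Maybe ℕ) where

  open Common I renaming (n to N)
  open Walk
  open Routing

  D : List (Fin N)
  D = tabulateOn depots (λ d _ → d)

  items : Route N
  items = tabulateOn clients (λ c c∈C → c , demand c c∈C)

  FeasibleRouting : Routing I → Set
  FeasibleRouting R =
    (∀ i → sum (tabulateOn clients λ c c∈C →
                  if does (assign R c c∈C ≟ i) then demand c c∈C else 0) ≤ ℓ) ×
    (∀ i → Maybe.All (walkWeight (walk R i) ≤_) g)

  fromLinked : ∀ {v vs} (l : Linked Adjacent (v ∷ vs)) →
               IsWalk weight v (List⁺.last (v ∷ vs)) (totalWeight l) (v ∷ vs)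
  fromLinked [-] = [ _ ]
  fromLinked {v} {u ∷ us} ((ω , e) ∷ l) =
    subst (λ d → IsWalk weight v d _ _) (sym (last-∷ v u us)) (e ∷ fromLinked l)

  toWalk : ∀ {v d w p} → IsWalk weight v d w p →
           ∃[ q ] toList (vertices q) ≡ p × start q ≡ v × end q ≡ d × walkWeight q ≡ w
  toWalk [ d ] = record { vertices = d ∷ [] ; linked = [-] } , refl , refl , refl , refl
  toWalk (_∷_ {u = u} {ω = ω} e q) with toWalk q
  ... | record { vertices = v ∷ vs ; linked = l } , refl , refl , refl , refl =
    record { vertices = u ∷ v ∷ vs ; linked = (ω , e) ∷ l } , refl , refl , last-∷ u v vs , refl

  InOrder-∈ : ∀ {r : Route N} {p x} → InOrder r p → x ∈ r → proj₁ x ∈ p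
  InOrder-∈ (skip o) x∈          = there (InOrder-∈ o x∈)
  InOrder-∈ (take o) (here refl) = here refl
  InOrder-∈ (take o) (there x∈)  = InOrder-∈ o x∈

  module _ {rs w ps} (ts : Tours weight D ℓ g rs w ps) where
    private
      tourAt : ∀ {rs w ps} → Tours weight D ℓ g rs w ps → ∀ i →
               ∃[ w ] ∃[ p ] FeasibleTour weight D ℓ g (lookup rs i) w p
      tourAt (t ∷ ts) zero    = _ , _ , t
      tourAt (t ∷ ts) (suc i) = tourAt ts i

      weights : ∀ {rs w ps} (ts : Tours weight D ℓ g rs w ps) →
                sum (tabulate (proj₁ ∘ tourAt ts)) ≡ w
      weights []       = refl
      weights (t ∷ ts) = cong (_ +_) (weights ts)

      paths : ∀ {rs w ps} (ts : Tours weight D ℓ g rs w ps) →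
              tabulate (λ i → proj₁ (proj₂ (tourAt ts i))) ≡ ps
      paths []       = refl
      paths (t ∷ ts) = cong (_ ∷_) (paths ts)

      closedTour : ∀ i → ClosedTour weight D (lookup rs i) _ _
      closedTour i = proj₁ (proj₂ (proj₂ (tourAt ts i)))

      walkAt : ∀ i → ∃[ q ] _
      walkAt i = toWalk (proj₁ (proj₂ (proj₂ (closedTour i))))

    toRouting : ∀ {as} → length rs ≤ vehicles → Pointwise (Serves rs) items as →
                (∀ i → assignedLoad items as i ≡ load (route rs i)) →
                ∃[ R ] FeasibleRouting R × routingWeight R ≡ w × encodeRouting R ≡ encSolution (ps , as)
    toRouting {as} rs≤k serves loads with untabulateOn clients serves
    ... | number , refl , serves′ = R , (loads≤ , gas≤) , weight≡ , encode≡
      where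
      assign′ : ∀ c → c ∈ˢ clients → Fin (length rs)
      assign′ c c∈C = fromℕ< (proj₁ (serves′ c c∈C))

      toℕ-assign′ : ∀ c c∈C → toℕ (assign′ c c∈C) ≡ number c c∈C
      toℕ-assign′ c c∈C = toℕ-fromℕ< (proj₁ (serves′ c c∈C))

      R : Routing I
      R = record
        { k′      = length rs
        ; k′≤k    = rs≤k
        ; walk    = λ i → proj₁ (walkAt i)
        ; assign  = assign′
        ; atDepot = λ i → let d , d∈D , _ = closedTour i
                              _ , _ , start≡ , _ = walkAt i
                          in subst (_∈ˢ depots) (sym start≡)
                               (All.lookup (tabulateOn⁺ depots (λ _ d∈ → d∈)) d∈D)
        ; closed  = λ i → let _ , _ , start≡ , end≡ , _ = walkAt i in trans start≡ (sym end≡)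
        ; served  = λ c c∈C →
            let i = assign′ c c∈C
                _ , _ , _ , o = closedTour i
                x∈ = subst (_ ∈_) (trans (cong (route rs) (sym (toℕ-assign′ c c∈C))) (route-lookup rs i))
                       (proj₂ (serves′ c c∈C))
            in subst (c ∈_) (sym (proj₁ (proj₂ (walkAt i)))) (InOrder-∈ o x∈)
        }

      loads≤ : ∀ i → sum (tabulateOn clients λ c c∈C →
                       if does (assign′ c c∈C ≟ i) then demand c c∈C else 0) ≤ ℓ
      loads≤ i = begin
        sum (tabulateOn clients λ c c∈C → if does (assign′ c c∈C ≟ i) then demand c c∈C else 0)
          ≡⟨ cong sum (tabulateOn-cong clients λ c c∈C → cong (if_then demand c c∈C else 0)
               (trans (does-toℕ-≟ (assign′ c c∈C) i) (cong (_≡ᵇ toℕ i) (toℕ-assign′ c c∈C)))) ⟩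
        sum (tabulateOn clients λ c c∈C → if number c c∈C ≡ᵇ toℕ i then demand c c∈C else 0)
          ≡⟨ cong sum (zipWith-tabulateOn _ clients _ number) ⟨
        assignedLoad items (tabulateOn clients number) (toℕ i)
          ≡⟨ loads (toℕ i) ⟩
        load (route rs (toℕ i))
          ≡⟨ cong load (route-lookup rs i) ⟩
        load (lookup rs i)
          ≤⟨ proj₁ (proj₂ (proj₂ (proj₂ (tourAt ts i)))) ⟩
        ℓ ∎
        where open ≤-Reasoning

      walkWeight≡ : ∀ i → walkWeight (walk R i) ≡ proj₁ (tourAt ts i)
      walkWeight≡ i = proj₂ (proj₂ (proj₂ (proj₂ (walkAt i))))

      gas≤ : ∀ i → Maybe.All (walkWeight (walk R i) ≤_) g
      gas≤ i = subst (λ w → Maybe.All (w ≤_) g) (sym (walkWeight≡ i))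
                 (proj₂ (proj₂ (proj₂ (proj₂ (tourAt ts i)))))

      weight≡ : routingWeight R ≡ w
      weight≡ = trans (cong sum (tabulate-cong walkWeight≡)) (weights ts)

      encode≡ : encodeRouting R ≡ encSolution (ps , tabulateOn clients number)
      encode≡ = cong₂ cons
        (cong list (begin
          tabulate (λ i → encPath (toList (vertices (walk R i))))
            ≡⟨ tabulate-cong (λ i → cong encPath (proj₁ (proj₂ (walkAt i)))) ⟩
          tabulate (λ i → encPath (proj₁ (proj₂ (tourAt ts i))))
            ≡⟨ map-tabulate _ encPath ⟨
          map encPath (tabulate (λ i → proj₁ (proj₂ (tourAt ts i))))
            ≡⟨ cong (map encPath) (paths ts) ⟩
          map encPath ps ∎))
        (cong list (trans
          (tabulateOn-cong clients (λ c c∈C → cong num (toℕ-assign′ c c∈C)))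
          (sym (map-tabulateOn num clients number))))
        where open ≡-Reasoning

  best : Best (Solution N)
  best = optimum weight D items vehicles ℓ g

  Solves : ℕ → Solution N → Set
  Solves w s = ∃[ R ] FeasibleRouting R × routingWeight R ≡ w × encodeRouting R ≡ encSolution s

  best-holds : Holds Solves best
  best-holds = Holds-map best solves (bestPlan-holds weight D ℓ g vehicles (plans items))
    where
    solves : ∀ {w s} → Any (λ p → Realises weight D ℓ g vehicles p w s) (plans items) → Solves w s
    solves realised with find realised
    ... | (as , rs) , p∈ , refl , rs≤k , ts with All.lookup (plans-sound items) p∈
    ...   | loads , serves = toRouting ts rs≤k serves loads

  -- The plan that imitates R keeps only vehicles with a route, and their walks in R are feasible
  -- closed tours for these routes. The search therefore finds at most the sum of their weights, and
  -- the dropped walks could only add to it.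
  best-≼ : ∀ R → FeasibleRouting R → best ≼ routingWeight R
  best-≼ R (loads≤ , gas≤) =
    ≼-trans (bestPlan-≼ weight D ℓ g vehicles p∈′ (evaluate-≼ weight D ℓ g vehicles rs≤k allFeasible))
      sum≤
    where
    π : Fin (k′ R) → Path N
    π j = toList (vertices (walk R j))
    ω : Fin (k′ R) → ℕ
    ω j = walkWeight (walk R j)
    zs = tabulateOn clients (λ c c∈C → (c , demand c c∈C) , assign R c c∈C)
    complete = plans-complete π zs (tabulateOn⁺ clients (served R))
    as = proj₁ complete
    rs = proj₁ (proj₂ complete)
    p∈ = proj₁ (proj₂ (proj₂ complete))
    us = proj₁ (proj₂ (proj₂ (proj₂ complete)))
    vs = proj₁ (proj₂ (proj₂ (proj₂ (proj₂ complete))))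
    perm = proj₁ (proj₂ (proj₂ (proj₂ (proj₂ (proj₂ complete)))))
    fits = proj₂ (proj₂ (proj₂ (proj₂ (proj₂ (proj₂ complete)))))

    p∈′ : (as , rs) ∈ plans items
    p∈′ = subst (λ xs → (as , rs) ∈ plans xs) (map-tabulateOn proj₁ clients _) p∈

    rs≤k : length rs ≤ vehicles
    rs≤k = begin
      length rs              ≡⟨ Pointwise.Pointwise-length fits ⟩
      length us              ≤⟨ m≤m+n _ _ ⟩
      length us + length vs  ≡⟨ length-++ us ⟨
      length (us ++ vs)      ≡⟨ ↭-length perm ⟩
      length (allFin (k′ R)) ≡⟨ length-tabulate _ ⟩
      k′ R                   ≤⟨ k′≤k R ⟩
      vehicles               ∎
      where open ≤-Reasoning

    isWalk : ∀ j → IsWalk weight (start (walk R j)) (start (walk R j)) (ω j) (π j)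
    isWalk j = subst (λ d → IsWalk weight (start (walk R j)) d (ω j) (π j)) (sym (closed R j)) (fromLinked (linked (walk R j)))

    feasible : ∀ {r} j → Fits π zs r j → ∃[ p ] FeasibleTour weight D ℓ g r (ω j) p
    feasible j (o , l≤) = _ ,
      (_ , ∈-tabulateOn _ (atDepot R j) , isWalk j , o) ,
      ≤-trans l≤ (≤-trans (≤-reflexive (cong sum (map-tabulateOn _ clients _))) (loads≤ j)) ,
      gas≤ j

    allFeasible : Pointwise (λ r w → ∃[ p ] FeasibleTour weight D ℓ g r w p) rs (map ω us)
    allFeasible = go fits
      where
      go : ∀ {rs us} → Pointwise (Fits π zs) rs us →
           Pointwise (λ r w → ∃[ p ] FeasibleTour weight D ℓ g r w p) rs (map ω us)
      go []                  = []
      go {us = u ∷ _} (f ∷ fs) = feasible u f ∷ go fs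

    sum≤ : sum (map ω us) ≤ routingWeight R
    sum≤ = begin
      sum (map ω us)                     ≤⟨ m≤m+n _ _ ⟩
      sum (map ω us) + sum (map ω vs)    ≡⟨ sum-++ (map ω us) _ ⟨
      sum (map ω us ++ map ω vs)         ≡⟨ cong sum (map-++ ω us vs) ⟨
      sum (map ω (us ++ vs))             ≡⟨ sum-↭ (map⁺ ω perm) ⟩
      sum (map ω (allFin (k′ R)))        ≡⟨ cong sum (map-tabulate (λ j → j) ω) ⟩
      routingWeight R                    ∎
      where open ≤-Reasoning

-- The three problems

input : ∀ i {m} → Exp 1 (suc m)
input i = call getF (lit i ∷ v 0 ∷ [])

result : (X → Val) → Best X → Val
result enc nothing        = nil
result enc (just (_ , x)) = enc x

resultF loadCVRPF gasCVRPF loadGasCVRPF : Fun 1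
zipF uncapacitatedF : Fun 2

resultF = fun (caseList (v 0) nil (v 1))

zipF = fun
  (caseList (v 0) nil
  (caseList (v 3) nil
  (cons (cons (v 2) (v 0)) (self (v 3 ∷ v 1 ∷ [])))))

uncapacitatedF = fun (cons (v 0) (lit 0))

loadCVRPF = fun
  (call resultF (call optimumF
    ( input 0 ∷ input 1 ∷ call zipF (input 2 ∷ input 5 ∷ []) ∷ input 3 ∷ input 4 ∷ nil ∷ []) ∷ []))

gasCVRPF = fun
  (call resultF (call optimumF
    ( input 0 ∷ input 1 ∷ call (mapF uncapacitatedF) (input 2 ∷ nil ∷ []) ∷ input 3
    ∷ lit 0 ∷ cons (input 4) nil ∷ []) ∷ []))

loadGasCVRPF = fun
  (call resultF (call optimumF
    ( input 0 ∷ input 1 ∷ call zipF (input 2 ∷ input 5 ∷ []) ∷ input 3 ∷ input 4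
    ∷ cons (input 6) nil ∷ []) ∷ []))

cResult cZip cUncapacitated : Poly
cInput : ℕ → Poly
cResult        = ‵ (overhead resultF + 0 + 0)
cZip           = (‵ 1 ⊕ 𝕟) ⊗ loop zipF (‵ 0)
cUncapacitated = ‵ (overhead uncapacitatedF + 0 + 0)
cInput m       = ‵ (suc m) ⊗ loop getF (‵ 0)

bLoadCVRP bGasCVRP bLoadGasCVRP cLoadCVRP cGasCVRP cLoadGasCVRP : Poly
-- The arguments of `cInput` are the lengths of the encodings: four common entries, two for the
-- loads, one for the gas.
bLoadCVRP    = i ⊕ i ⊕ i ⊕ i ⊕ cZip ⊕ i ⊕ i ⊕ cOptimum ⊕ cResult
  where i = cInput 6
bGasCVRP     = i ⊕ i ⊕ i ⊕ (‵ 1 ⊕ 𝕟) ⊗ loop (mapF uncapacitatedF) cUncapacitated ⊕ i ⊕ i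
             ⊕ cOptimum ⊕ cResult
  where i = cInput 5
bLoadGasCVRP = i ⊕ i ⊕ i ⊕ i ⊕ cZip ⊕ i ⊕ i ⊕ i ⊕ cOptimum ⊕ cResult
  where i = cInput 7
cLoadCVRP    = ‵ overhead loadCVRPF ⊕ bLoadCVRP ⊕ ‵ 0
cGasCVRP     = ‵ overhead gasCVRPF ⊕ bGasCVRP ⊕ ‵ 0
cLoadGasCVRP = ‵ overhead loadGasCVRPF ⊕ bLoadGasCVRP ⊕ ‵ 0

result-spec : ∀ (enc : X → Val) e →
  resultF · encBest enc e ∷ [] ⇓≤ result enc e ⟨ overhead resultF + 0 + 0 ⟩
result-spec enc nothing        = run resultF 0 0 (refl , z≤n , z≤n)
result-spec enc (just (w , x)) = run resultF 0 0 (refl , z≤n , z≤n)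

sum-zeros : ∀ (S : Subset m) {f : ∀ v → v ∈ˢ S → ℕ} → (∀ v v∈S → f v v∈S ≡ 0) → sum (tabulateOn S f) ≡ 0
sum-zeros []            eq = refl
sum-zeros (inside  ∷ S) eq = cong₂ _+_ (eq zero Vec.here) (sum-zeros S λ v v∈S → eq (suc v) (Vec.there v∈S))
sum-zeros (outside ∷ S) eq = sum-zeros S λ v v∈S → eq (suc v) (Vec.there v∈S)

module _ (P : Problem) where
  open Problem P

  module _ (J : Instance) (demand : ∀ c → c ∈ˢ Common.clients (common J) → ℕ)
    (ℓ : ℕ) (g : Maybe ℕ)
    (to   : ∀ {R} → Feasible J R → Correctness.FeasibleRouting (common J) demand ℓ g R)
    (from : ∀ {R} → Correctness.FeasibleRouting (common J) demand ℓ g R → Feasible J R) where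

    open Common (common J) renaming (n to N)
    open Correctness (common J) demand ℓ g

    answer : Answer J (result encSolution best)
    answer with best | best-holds | best-≼
    -- A feasible routing would make `nothing` bounded by its weight, but `≼` holds only of an
    -- actual result.
    ... | nothing      | _                        | least = infeasible λ R f → case-≼ (least R (to f))
      where
      case-≼ : ∀ {w} → nothing {A = ℕ × Solution N} ≼ w → ⊥
      case-≼ ()
    ... | just (w , s) | R , feasible , refl , enc≡ | least =
      subst (Answer J) enc≡ (optimal R (from feasible , λ R′ f → bound (least R′ (to f))))
      where
      bound : ∀ {w w′} → just (w , s) ≼ w′ → w ≤ w′
      bound (attains w≤w′) = w≤w′

  solvable : ∀ f p →
    (∀ J → let open Common (common J) renaming (n to N) in
       ∃[ out ] Answer J out ×
                f · encode J ∷ [] ⇓≤ out ⟨ ⟦ p ⟧ N ((1 + 2 * ∣ clients ∣) ^ ∣ clients ∣) ⟩) →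
    SolvableInClientTime P
  solvable f p run-f with poly-plans-bound p
  ... | A , B , D , bound = f , A , B , D , λ J →
    let open Common (common J) renaming (n to N)
        out , ans , t , d , t≤ = run-f J
    in out , t , d , ans , ≤-trans t≤ (bound ∣ clients ∣ N (nonempty (proj₁ hasDepot)))
    where
    -- Applied to a depot, this gives the positive number of vertices that the polynomial bounds
    -- require.
    nonempty : Fin m → 1 ≤ m
    nonempty zero    = s≤s z≤n
    nonempty (suc _) = s≤s z≤n

-- Running the search on encoded instances

module Run (I : Common) (demand : ∀ c → c ∈ˢ Common.clients I → ℕ)
           (ℓ : ℕ) (g : Maybe ℕ) where

  open Common I renaming (n to N)

  private
    c = ∣ clients ∣
    M = (1 + 2 * c) ^ c
  open Spec N M public
  open Correctness I demand ℓ g public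

  items≤c : length items ≤ c
  items≤c = ≤-reflexive (length-tabulateOn clients _)

  zip-spec : ∀ (S : Subset m) (f h : ∀ v → v ∈ˢ S → Val) →
    zipF · list (tabulateOn S f) ∷ list (tabulateOn S h) ∷ []
      ⇓≤ list (tabulateOn S λ v v∈S → cons (f v v∈S) (h v v∈S)) ⟨ suc m * cost (loop zipF (‵ 0)) ⟩
  zip-spec []            f h = run zipF 0 0 (refl , z≤n , z≤n)
  zip-spec {suc m} (inside  ∷ S) f h = run zipF 0 (suc m * cost (loop zipF (‵ 0)))
    (_ , _ , zip-spec S _ _ , refl , z≤n , ≤-refl)
  -- A vertex outside S leaves no trace in the lists; its share of the bound is slack.
  zip-spec (outside ∷ S) f h = ⇓≤-mono (m≤n+m _ (cost (loop zipF (‵ 0)))) (zip-spec S _ _)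

  depots≡ : list (tabulateOn depots λ d _ → vertex d) ≡ encPath D
  depots≡ = sym (cong list (map-tabulateOn vertex depots _))

  items≡ : list (tabulateOn clients λ c c∈C → cons (vertex c) (num (demand c c∈C))) ≡ encRoute items
  items≡ = sym (cong list (map-tabulateOn encClient clients _))

  clients≡ : list (tabulateOn clients λ c _ → vertex c) ≡ encPath (tabulateOn clients λ c _ → c)
  clients≡ = sym (cong list (map-tabulateOn vertex clients _))

  into : ∀ {a} {f : Fun a} {vs v w t} → v ≡ w → f · vs ⇓≤ v ⟨ t ⟩ → f · vs ⇓≤ w ⟨ t ⟩
  into refl d = d

  best-spec : optimumF · encMatrix weight ∷ encPath D ∷ encRoute items ∷ num vehicles ∷ num ℓ ∷ encEntry g ∷ []
    ⇓≤ encBest encSolution best ⟨ cost cOptimum ⟩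
  best-spec = optimum-spec (∣p∣≤n clients) ≤-refl weight D items vehicles ℓ g
    (≤-trans (≤-reflexive (length-tabulateOn depots _)) (∣p∣≤n depots)) items≤c

loadCVRP : SolvableInClientTime LoadCVRP
loadCVRP = solvable LoadCVRP loadCVRPF cLoadCVRP λ J@(I , L) →
  let open Load L
      open Run I demand capacity nothing
      args = Vec.fromList (encodeCommon I ++ encodeLoad L)
  in _ , answer LoadCVRP J demand capacity nothing
           (λ load≤ → load≤ , λ _ → Maybe.nothing) proj₁
       , run loadCVRPF (cost bLoadCVRP) 0
           ( _ , _ , get-spec (Vec.lookup args) (# 0)
           , _ , _ , into depots≡ (get-spec (Vec.lookup args) (# 1))
           , _ , _ , get-spec (Vec.lookup args) (# 2)
           , _ , _ , get-spec (Vec.lookup args) (# 5)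
           , _ , _ , into items≡ (zip-spec (Common.clients I) _ _)
           , _ , _ , get-spec (Vec.lookup args) (# 3)
           , _ , _ , get-spec (Vec.lookup args) (# 4)
           , _ , _ , best-spec
           , _ , _ , result-spec encSolution best
           , refl , ≤-refl , z≤n)

gasCVRP : SolvableInClientTime GasCVRP
gasCVRP = solvable GasCVRP gasCVRPF cGasCVRP λ J@(I , G) →
  let open Gas G
      open Run I (λ _ _ → 0) 0 (just capacity)
      args = Vec.fromList (encodeCommon I ++ encodeGas G)
  in _ , answer GasCVRP J (λ _ _ → 0) 0 (just capacity)
           (λ gas≤ → (λ i → ≤-reflexive (sum-zeros (Common.clients I) λ _ _ → if-same _))
                   , (λ i → Maybe.just (gas≤ i)))
           (λ (_ , gas≤) i → Maybe.drop-just (gas≤ i))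
       , run gasCVRPF (cost bGasCVRP) 0
           ( _ , _ , get-spec (Vec.lookup args) (# 0)
           , _ , _ , into depots≡ (get-spec (Vec.lookup args) (# 1))
           , _ , _ , into clients≡ (get-spec (Vec.lookup args) (# 2))
           , _ , _ , into
               (cong (encList encClient) (map-tabulateOn (_, 0) (Common.clients I) _))
               (⇓≤-mono (rounds (loop (mapF uncapacitatedF) cUncapacitated)
                          (s≤s (≤-trans (≤-reflexive (length-tabulateOn (Common.clients I) _))
                                        (∣p∣≤n (Common.clients I)))))
                 (map-spec cUncapacitated vertex encClient (λ c → c , 0)
                   (λ _ → run uncapacitatedF 0 0 (refl , z≤n , z≤n))
                   (tabulateOn (Common.clients I) λ c _ → c)))
           , _ , _ , get-spec (Vec.lookup args) (# 3)
           , _ , _ , get-spec (Vec.lookup args) (# 4)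
           , _ , _ , best-spec
           , _ , _ , result-spec encSolution best
           , refl , ≤-refl , z≤n)
  where
  if-same : ∀ b → (if b then 0 else 0) ≡ 0
  if-same true  = refl
  if-same false = refl

loadGasCVRP : SolvableInClientTime LoadGasCVRP
loadGasCVRP = solvable LoadGasCVRP loadGasCVRPF cLoadGasCVRP λ J@(I , L , G) →
  let open Load L
      open Run I demand capacity (just (Gas.capacity G))
      args = Vec.fromList (encodeCommon I ++ encodeLoad L ++ encodeGas G)
  in _ , answer LoadGasCVRP J demand capacity (just (Gas.capacity G))
           (λ (load≤ , gas≤) → load≤ , λ i → Maybe.just (gas≤ i))
           (λ (load≤ , gas≤) → load≤ , λ i → Maybe.drop-just (gas≤ i))
       , run loadGasCVRPF (cost bLoadGasCVRP) 0
           ( _ , _ , get-spec (Vec.lookup args) (# 0)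
           , _ , _ , into depots≡ (get-spec (Vec.lookup args) (# 1))
           , _ , _ , get-spec (Vec.lookup args) (# 2)
           , _ , _ , get-spec (Vec.lookup args) (# 5)
           , _ , _ , into items≡ (zip-spec (Common.clients I) _ _)
           , _ , _ , get-spec (Vec.lookup args) (# 3)
           , _ , _ , get-spec (Vec.lookup args) (# 4)
           , _ , _ , get-spec (Vec.lookup args) (# 6)
           , _ , _ , best-spec
           , _ , _ , result-spec encSolution best
           , refl , ≤-refl , z≤n)

theorem4p1 : SolvableInClientTime LoadCVRP
    × SolvableInClientTime GasCVRP
    × SolvableInClientTime LoadGasCVRP
theorem4p1 = loadCVRP , gasCVRP , loadGasCVRP
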